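{- The circuit equivalence problem for $\mathrm{CC}[2,3,2]$-circuits can be polytime-reduced to the following problem: given $k,n\in\mathbb{N}$ and expanded polynomials $p_1,\dots,p_k\in\mathbb{Z}_3[x_1,\dots,x_n]$, decide whether $\sum_{i=1}^k\alpha^{p_i(\mathbf{a})}=0$ for all $\mathbf{a}\in\{ -1,1\}^n$.
   Context: $\alpha$ is a primitive element of the field $\mathbb{F}_4$; since $\alpha^3=1$, $\alpha^t$ is defined for $t\in\mathbb{Z}_3$; $p_i(\mathbf{a})$ is computed in $\mathbb{Z}_3$ and the sum in $\mathbb{F}_4$. An expanded polynomial is given as $\sum_{\mathbf{e}\in I}c_{\mathbf{e}}x_1^{e_1}\cdots x_n^{e_n}$ with $I\subseteq\{0,1,2\}^n$ and $c_{\mathbf{e}}\in\mathbb{Z}_3\setminus\{0\}$. A $\mathrm{CC}[2,3,2]$-circuit on inputs $y_1,\dots,y_n\in\{0,1\}$ is a depth-3 circuit with unbounded fan-in $\mathrm{MOD}_2$, $\mathrm{MOD}_3$, $\mathrm{MOD}_2$ gates at depths $1,2,3$ (a $\mathrm{MOD}_m$ gate outputs $1$ iff the sum of its inputs, with multiplicity, is divisible by $m$, else $0$), some input wires possibly constant $1$; equivalently an expression $\mathrm{Mod}_2\big(c_0+\sum_{i=1}^k\mathrm{Mod}_3\big(c_1(i)+\sum_{j=1}^{l(i)}\mathrm{Mod}_2(c_2(i,j)+\sum_{m=1}^n e(i,j,m)y_m)\big)\big)$ with nonnegative integer constants, $\mathrm{Mod}_r(z)=1$ iff $r\mid z$. Its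 size is the number of gates. The circuit equivalence problem asks, given such a circuit $C$, whether $C$ evaluates to $1$ on every input vector. Polytime-reducible: there is a polynomial-time transformation $P$ of inputs with $A(e)\iff B(P(e))$. -}

module Defs where

open import Data.Nat using (ℕ; NonZero; zero; suc; _+_; _*_; _^_; _≤_; _%_; _≡ᵇ_)
open import Data.Nat.DivMod using (_mod_)
open import Data.Bool using (Bool; true; false; if_then_else_)
open import Data.Fin using (Fin; toℕ) renaming (zero to 0F)
open import Data.List using (List; []; _∷_; _++_; map; length)
open import Data.Nat.ListAction using (sum; product)
open import Data.List.Relation.Unary.All using (All)
open import Data.List.Relation.Unary.Unique.Propositional using (Unique)
open import Data.Vec using (Vec; toList; zipWith)
open import Data.Product using (Σ; _×_; _,_; proj₁; proj₂)
open import Data.Maybe using (Maybe; just; nothing)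
open import Relation.Binary.PropositionalEquality using (_≡_; _≢_)
open import Function.Bundles using (_⇔_)

modGate : (r : ℕ) → .{{_ : NonZero r}} → ℕ → Bool
modGate r z = (z % r) ≡ᵇ 0

b2n : Bool → ℕ
b2n true  = 1
b2n false = 0

-- CC[2,3,2] circuits, in the expression form
-- Mod2(c0 + Σ_i Mod3(c1(i) + Σ_j Mod2(c2(i,j) + Σ_m e(i,j,m) y_m)))

-- bottom MOD2 gate: constant c2(i,j) and multiplicities e(i,j,1..n)
record Mod2Gate (n : ℕ) : Set where
  constructor mod2
  field
    c2 : ℕ
    e  : Vec ℕ n

record Mod3Gate (n : ℕ) : Set where
  constructor mod3
  field
    c1    : ℕ
    ins   : List (Mod2Gate n)

record Circuit : Set where
  constructor circuit
  field
    n     : ℕ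
    c0    : ℕ
    gates : List (Mod3Gate n)

evalMod2 : ∀ {n} → Vec Bool n → Mod2Gate n → Bool
evalMod2 y (mod2 c2 e) =
  modGate 2 (c2 + sum (toList (zipWith (λ ei yi → ei * b2n yi) e y)))

evalMod3 : ∀ {n} → Vec Bool n → Mod3Gate n → Bool
evalMod3 y (mod3 c1 ins) = modGate 3 (c1 + sum (map (λ g → b2n (evalMod2 y g)) ins))

evalCircuit : (C : Circuit) → Vec Bool (Circuit.n C) → Bool
evalCircuit (circuit n c0 gates) y =
  modGate 2 (c0 + sum (map (λ g → b2n (evalMod3 y g)) gates))

CircuitEquivalent : Circuit → Set
CircuitEquivalent C = (y : Vec Bool (Circuit.n C)) → evalCircuit C y ≡ true

-- The field F4 = {0, 1, α, α²}, with α² = α + 1 (α primitive, α³ = 1)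

data F4 : Set where
  𝟘 𝟙 α α² : F4

_⊕_ : F4 → F4 → F4
𝟘  ⊕ y  = y
x  ⊕ 𝟘  = x
𝟙  ⊕ 𝟙  = 𝟘
𝟙  ⊕ α  = α²
𝟙  ⊕ α² = α
α  ⊕ 𝟙  = α²
α  ⊕ α  = 𝟘
α  ⊕ α² = 𝟙
α² ⊕ 𝟙  = α
α² ⊕ α  = 𝟙
α² ⊕ α² = 𝟘

αpow : Fin 3 → F4
αpow t with toℕ t
... | 0 = 𝟙
... | 1 = α
... | _ = α²

sumF4 : List F4 → F4
sumF4 []       = 𝟘
sumF4 (x ∷ xs) = x ⊕ sumF4 xs

-- Expanded polynomials over Z_3 in x_1..x_n:
-- a list of terms (c_e, e) with c_e ∈ Z_3, e ∈ {0,1,2}^n.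

Term : ℕ → Set
Term n = Fin 3 × Vec (Fin 3) n

Poly : ℕ → Set
Poly n = List (Term n)

ValidPoly : ∀ {n} → Poly n → Set
ValidPoly p = All (λ t → proj₁ t ≢ 0F) p × Unique (map proj₂ p)

-- value of a_m ∈ {-1,1} as a natural representative mod 3: 1 ↦ 1, -1 ↦ 2
pm1 : Bool → ℕ
pm1 true  = 1
pm1 false = 2

-- p(a) ∈ Z_3 for a ∈ {-1,1}^n  (a_m = 1 encoded by true, a_m = -1 by false)
evalTerm : ∀ {n} → Vec Bool n → Term n → ℕ
evalTerm a (c , e) =
  toℕ c * product (toList (zipWith (λ em am → pm1 am ^ toℕ em) e a))

evalPoly : ∀ {n} → Vec Bool n → Poly n → Fin 3
evalPoly a p = sum (map (evalTerm a) p) mod 3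

record PolyInstance : Set where
  constructor polyInstance
  field
    n     : ℕ
    polys : List (Poly n)

ValidInstance : PolyInstance → Set
ValidInstance (polyInstance n polys) = All ValidPoly polys

AllZero : PolyInstance → Set
AllZero (polyInstance n polys) =
  (a : Vec Bool n) → sumF4 (map (λ p → αpow (evalPoly a p)) polys) ≡ 𝟘

-- Binary encodings of instances (prefix-free; naturals in unary)

encℕ : ℕ → List Bool
encℕ zero    = false ∷ []
encℕ (suc k) = true ∷ encℕ k

encList : ∀ {A : Set} → (A → List Bool) → List A → List Bool
encList f []       = false ∷ []
encList f (x ∷ xs) = true ∷ (f x ++ encList f xs)

encVec : ∀ {A : Set} {n} → (A → List Bool) → Vec A n → List Bool
encVec f v = encList f (toList v)

encFin : ∀ {k} → Fin k → List Bool
encFin i = encℕ (toℕ i)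

encMod2 : ∀ {n} → Mod2Gate n → List Bool
encMod2 (mod2 c2 e) = encℕ c2 ++ encVec encℕ e

encMod3 : ∀ {n} → Mod3Gate n → List Bool
encMod3 (mod3 c1 ins) = encℕ c1 ++ encList encMod2 ins

encCircuit : Circuit → List Bool
encCircuit (circuit n c0 gates) = encℕ n ++ encℕ c0 ++ encList encMod3 gates

encTerm : ∀ {n} → Term n → List Bool
encTerm (c , e) = encFin c ++ encVec encFin e

encInstance : PolyInstance → List Bool
encInstance (polyInstance n polys) = encℕ n ++ encList (encList encTerm) polys

PolyZeroLang : List Bool → Set
PolyZeroLang s =
  Σ PolyInstance λ I → ValidInstance I × encInstance I ≡ s × AllZero I

data Sym (g : ℕ) : Set where
  blank : Sym g
  bit   : Bool → Sym g
  extra : Fin g → Sym g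

data Move : Set where
  L R S : Move

record TM : Set where
  field
    q : ℕ   -- states are Fin (suc q), start state 0
    g : ℕ
    δ : Fin (suc q) → Sym g → Maybe (Fin (suc q) × Sym g × Move)
    -- δ s σ = nothing means the machine halts

record Config (M : TM) : Set where
  constructor cfg
  field
    state : Fin (suc (TM.q M))
    left  : List (Sym (TM.g M))   -- cells left of the head, nearest first
    here  : Sym (TM.g M)
    right : List (Sym (TM.g M))

initConfig : (M : TM) → List Bool → Config M
initConfig M []       = cfg 0F [] blank []
initConfig M (b ∷ bs) = cfg 0F [] (bit b) (map bit bs)

step : (M : TM) → Config M → Maybe (Config M)
step M (cfg s l h r) with TM.δ M s h
... | nothing = nothing
... | just (s' , σ , S) = just (cfg s' l σ r)
... | just (s' , σ , R) with r
...   | []     = just (cfg s' (σ ∷ l) blank [])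
...   | x ∷ r' = just (cfg s' (σ ∷ l) x r')
step M (cfg s l h r) | just (s' , σ , L) with l
...   | []     = just (cfg s' [] σ r)          -- at the left end: stay
...   | x ∷ l' = just (cfg s' l' x (σ ∷ r))

runFor : (M : TM) → ℕ → Config M → Maybe (Config M)
runFor M zero c with step M c
... | nothing = just c
... | just _  = nothing
runFor M (suc t) c with step M c
... | nothing = just c
... | just c' = runFor M t c'

readBits : ∀ {g} → List (Sym g) → List Bool
readBits []            = []
readBits (bit b ∷ xs)  = b ∷ readBits xs
readBits (blank ∷ _)   = []
readBits (extra _ ∷ _) = []

output : {M : TM} → Config M → List Bool
output (cfg _ _ h r) = readBits (h ∷ r)

PolyTime : (List Bool → List Bool) → Set
PolyTime f =
  Σ TM λ M → Σ ℕ λ c → Σ ℕ λ d → (x : List Bool) →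
    Σ ℕ λ t → t ≤ c * length x ^ d + c ×
      Σ (Config M) λ c' → runFor M t (initConfig M x) ≡ just c' × output c' ≡ f x

CC232EquivReducesToPolyZero : Set
CC232EquivReducesToPolyZero =
  Σ (List Bool → List Bool) λ P → PolyTime P ×
    ((C : Circuit) → CircuitEquivalent C ⇔ PolyZeroLang (P (encCircuit C)))

{-# OPTIONS --safe #-}

-- Put a_m = (-1)^{y_m}. Modulo 3 a MOD₂ gate has the value 2 + 2 (-1)^c ∏ a_m^{e_m}, so the sum q at
-- the inputs of a MOD₃ gate is a polynomial in a, and the value of the gate is 1 + α^q + α^{2q} in F4.
-- Like terms need not be collected: the instance gets one extra variable for every position of the
-- encoded circuit after the block 1ⁿ, and since the square of such a variable is 1, each term can be
-- multiplied by the square of the variable of the position that produces it, which makes all the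
-- monomials of a polynomial distinct. The variables are then in bijection with the input positions
-- (those of the block 1ⁿ being the variables of the circuit), and the output is produced by a finite
-- control with two heads on the input, which a Turing machine simulates by marking head positions.
module Submission where

open import Algebra.Bundles using (CommutativeSemigroup)
import Algebra.Properties.CommutativeSemigroup
open import Data.Bool using (Bool; true; false; not; _xor_; if_then_else_)
open import Data.Bool.Properties using (xor-assoc; xor-comm; xor-identityʳ; not-involutive; not-distribˡ-xor)
open import Data.Fin using (Fin; zero; suc; toℕ; inject₁)
open import Data.Fin.Patterns using (0F; 1F; 2F; 3F; 4F; 5F; 6F; 7F; 8F)
open import Data.Fin.Properties using (1↔⊤; 2↔Bool; +↔⊎; *↔×; toℕ-inject₁; toℕ<n; toℕ-injective; toℕ-fromℕ<)
open import Data.List using (List; []; _∷_; _++_; _ʳ++_; map; length; replicate)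
open import Data.List.Properties
  using (++-assoc; ++-identityʳ; ++-ʳ++; map-++; map-∘; length-++; length-map; length-replicate;
         ∷-injective; ∷-injectiveʳ)
open import Data.List.Relation.Unary.All using (All; []; _∷_)
import Data.List.Relation.Unary.All as All
open import Data.List.Relation.Unary.All.Properties using (++⁺; map⁺; replicate⁺)
open import Data.List.Relation.Unary.AllPairs using ([]; _∷_)
open import Data.Maybe using (Maybe; just; nothing)
import Data.Maybe as Maybe
open import Data.Nat using (ℕ; zero; suc; _+_; _*_; _^_; _≤_; _<_; z≤n; s≤s; _%_; _≡ᵇ_)
open import Data.Nat.DivMod using (_mod_; %-distribˡ-+; %-distribˡ-*; m%n<n; m%n%n≡m%n; [m+n]%n≡m%n)
open import Data.Nat.ListAction using (sum; product)
open import Data.Nat.ListAction.Properties using (sum-++)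
open import Data.Nat.Properties
open import Data.Nat.Tactic.RingSolver using (solve-∀)
open import Data.Product using (∃; ∃₂; _×_; _,_; proj₁; proj₂)
open import Data.Product.Function.NonDependent.Propositional using (_×-↪_)
open import Data.Sum using (_⊎_; inj₁; inj₂)
open import Data.Sum.Function.Propositional using (_⊎-↪_)
open import Data.Unit using (⊤; tt)
open import Data.Vec as Vec using (Vec; []; _∷_; toList)
import Data.Vec.Properties as Vec
open import Function using (_∘_; id)
open import Function.Bundles using (_↪_; mk↪; _⇔_; mk⇔; module Equivalence; module RightInverse)
open import Function.Construct.Composition using (_↪-∘_)
open import Function.Construct.Symmetry using (↔-sym)
open import Function.Properties.Inverse using (↔⇒↪)
open import Relation.Binary.PropositionalEquality

open import Defs

open RightInverse using (to; from; strictlyInverseʳ)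

-- `PolyTime` asks for an explicit machine, so simplicity of the control is what shapes the
-- reduction. Collecting like terms would mean comparing monomials across the tape and adding
-- coefficients. Validity, however, only asks that the exponent vectors differ as vectors; terms
-- that agree as functions on the values ±1 may both stay. A finite control cannot number the terms,
-- but it can write one entry per tape cell with a 2 at a marked cell; this is why variables are
-- attached to positions. Unary numbers fit in: each unit of a constant c1 is a bit of its own,
-- hence a term of its own. A MOD₃ gate needs both q and 2q, whose terms come from the same bits,
-- while the outer head passes each bit once; hence the second scan. It is harmless that q and 2q
-- end up far apart, since the sum in F4 does not see the order. The summands 1, one for each unit
-- of c0 and one for each MOD₃ gate, are empty polynomials, as α^0 = 1.

Finite : Set → Set
Finite A = ∃ λ n → A ↪ Fin n

finite-via : {A B : Set} → A ↪ B → Finite B → Finite A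
finite-via f (n , g) = n , g ↪-∘ f

finite-⊤ : Finite ⊤
finite-⊤ = 1 , ↔⇒↪ (↔-sym 1↔⊤)

finite-Bool : Finite Bool
finite-Bool = 2 , ↔⇒↪ (↔-sym 2↔Bool)

finite-Fin : ∀ n → Finite (Fin n)
finite-Fin n = n , mk↪ {to = id} {from = id} λ { refl → refl }

infixr 1 _finite-⊎_
infixr 2 _finite-×_

_finite-⊎_ : {A B : Set} → Finite A → Finite B → Finite (A ⊎ B)
(m , f) finite-⊎ (n , g) = m + n , ↔⇒↪ (↔-sym +↔⊎) ↪-∘ (f ⊎-↪ g)

_finite-×_ : {A B : Set} → Finite A → Finite B → Finite (A × B)
(m , f) finite-× (n , g) = m * n , ↔⇒↪ (↔-sym *↔×) ↪-∘ (f ×-↪ g)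

-- A left inverse is all that `Simulation` uses: states and symbols are only ever decoded after
-- having been encoded.
retract : {A B : Set} (f : A → B) (g : B → A) → (∀ x → g (f x) ≡ x) → A ↪ B
retract f g eq = mk↪ {to = f} {from = g} λ { {x} refl → eq x }

-- Turing machines and step-bounded runs

data Symbol (E : Set) : Set where
  blank : Symbol E
  bit   : Bool → Symbol E
  ext   : E → Symbol E

-- Turing machines whose states and work symbols are arbitrary finite types.
module Simulation
  {St E : Set} {q g : ℕ} (St↪ : St ↪ Fin (suc q)) (E↪ : E ↪ Fin g)
  (δ : St → Symbol E → Maybe (St × Symbol E × Move))
  where

  encode : Symbol E → Sym g
  encode blank   = blank
  encode (bit b) = bit b
  encode (ext e) = extra (to E↪ e)

  decode : Sym g → Symbol E
  decode blank     = blank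
  decode (bit b)   = bit b
  decode (extra i) = ext (from E↪ i)

  decode-encode : ∀ x → decode (encode x) ≡ x
  decode-encode blank   = refl
  decode-encode (bit b) = refl
  decode-encode (ext e) = cong ext (strictlyInverseʳ E↪ e)

  encodeAction : St × Symbol E × Move → Fin (suc q) × Sym g × Move
  encodeAction (s , x , m) = to St↪ s , encode x , m

  machine : TM
  machine = record
    { q = q ; g = g
    ; δ = λ s x → Maybe.map encodeAction (δ (from St↪ s) (decode x)) }

  head : List (Symbol E) → Symbol E
  head []      = blank
  head (x ∷ _) = x

  tail : List (Symbol E) → List (Symbol E)
  tail []       = []
  tail (_ ∷ xs) = xs

  -- The scanned cell is the first entry of `r`. An empty `r` stands for a blank under the head,
  -- which is what `step` supplies when the head leaves the written part on the right.
  at : St → List (Symbol E) → List (Symbol E) → Config machine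
  at s l r = cfg (to St↪ s) (map encode l) (encode (head r)) (map encode (tail r))

  -- The configuration reached from at s l r by a move to the left.
  before : St → List (Symbol E) → List (Symbol E) → Config machine
  before s []      r = at s [] r
  before s (x ∷ l) r = at s l (x ∷ r)

  machine-δ : ∀ s x → TM.δ machine (to St↪ s) (encode x) ≡ Maybe.map encodeAction (δ s x)
  machine-δ s x rewrite strictlyInverseʳ St↪ s | decode-encode x = refl

  step-R : ∀ {s s′ x} l r → δ s (head r) ≡ just (s′ , x , R) →
           step machine (at s l r) ≡ just (at s′ (x ∷ l) (tail r))
  step-R {s} l r eq rewrite machine-δ s (head r) | eq with tail r
  ... | []    = refl
  ... | _ ∷ _ = refl

  step-S : ∀ {s s′ x} l r → δ s (head r) ≡ just (s′ , x , S) →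
           step machine (at s l r) ≡ just (at s′ l (x ∷ tail r))
  step-S {s} l r eq rewrite machine-δ s (head r) | eq = refl

  step-L : ∀ {s s′ x} l r → δ s (head r) ≡ just (s′ , x , L) →
           step machine (at s l r) ≡ just (before s′ l (x ∷ tail r))
  step-L {s} l r eq rewrite machine-δ s (head r) | eq with l
  ... | []    = refl
  ... | _ ∷ _ = refl

  step-halt : ∀ {s} l r → δ s (head r) ≡ nothing → step machine (at s l r) ≡ nothing
  step-halt {s} l r eq rewrite machine-δ s (head r) | eq = refl

  infix 4 _↝⟨_⟩_
  infixr 5 _◅_

  -- The index only bounds the number of steps, since `ε` accepts every `t`. Runs thus compose with
  -- rough estimates, and `runFor` tolerates the surplus fuel.
  data _↝⟨_⟩_ : Config machine → ℕ → Config machine → Set where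
    ε   : ∀ {c t} → c ↝⟨ t ⟩ c
    _◅_ : ∀ {c d e t} → step machine c ≡ just d → d ↝⟨ t ⟩ e → c ↝⟨ suc t ⟩ e

  weaken : ∀ {c d t u} → t ≤ u → c ↝⟨ t ⟩ d → c ↝⟨ u ⟩ d
  weaken _         ε       = ε
  weaken (s≤s t≤u) (p ◅ r) = p ◅ weaken t≤u r

  infixr 5 _▻_

  _▻_ : ∀ {c d e t u} → c ↝⟨ t ⟩ d → d ↝⟨ u ⟩ e → c ↝⟨ t + u ⟩ e
  _▻_ {t = t} ε r = weaken (m≤n+m _ t) r
  (p ◅ r) ▻ r′ = p ◅ (r ▻ r′)

  infixl 4 _▻◅_

  _▻◅_ : ∀ {c d e t} → c ↝⟨ t ⟩ d → step machine d ≡ just e → c ↝⟨ suc t ⟩ e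
  ε       ▻◅ p = p ◅ ε
  (q ◅ r) ▻◅ p = q ◅ (r ▻◅ p)

  runFor-halts : ∀ {c d t} → c ↝⟨ t ⟩ d → step machine d ≡ nothing →
                 runFor machine t c ≡ just d
  runFor-halts {t = zero}  ε eq rewrite eq = refl
  runFor-halts {t = suc _} ε eq rewrite eq = refl
  runFor-halts (p ◅ r) eq rewrite p = runFor-halts r eq

  initConfig-at : ∀ {s} x → to St↪ s ≡ zero → initConfig machine x ≡ at s [] (map bit x)
  initConfig-at []      eq rewrite eq = refl
  initConfig-at (b ∷ x) eq rewrite eq = cong (cfg _ _ _) (map-∘ x)

-- `code (suc c)` is also the bit that announces a list entry followed by `encFin c`; entries in
-- `Fin 3` therefore call for codes in `Fin 4`. The type is closed under `pop`, so the unwritten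
-- rest of a word fits into the state.
data Word : Set where
  ε one : Word
  code  : Fin 4 → Word

letters : Word → List Bool
letters ε        = []
letters one      = true ∷ []
letters (code k) = encFin k

pop : Word → Maybe (Bool × Word)
pop ε              = nothing
pop one            = just (true , ε)
pop (code zero)    = just (false , ε)
pop (code (suc k)) = just (true , code (inject₁ k))

finite-Word : Finite Word
finite-Word = finite-via (retract f g f-g) (finite-Bool finite-⊎ finite-Fin 4)
  where
  f : Word → Bool ⊎ Fin 4
  f ε        = inj₁ false
  f one      = inj₁ true
  f (code k) = inj₂ k
  g : Bool ⊎ Fin 4 → Word
  g (inj₁ false) = ε
  g (inj₁ true)  = one
  g (inj₂ k)     = code k
  f-g : ∀ x → g (f x) ≡ x
  f-g ε        = refl
  f-g one      = refl
  f-g (code k) = refl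

length-encℕ : ∀ n → length (encℕ n) ≡ suc n
length-encℕ zero    = refl
length-encℕ (suc n) = cong suc (length-encℕ n)

length-letters : ∀ u → length (letters u) ≤ 4
length-letters ε        = z≤n
length-letters one      = s≤s z≤n
length-letters (code k) rewrite length-encℕ (toℕ k) = toℕ<n k

-- A head p scans the input; at each position of p a second head scans the whole input, with the
-- position of p marked. In both scans words are appended to the output. The outer scan is
-- performed twice, the Bool argument of δₒ telling which.
module NestedTransducer
  {Q I : Set} (finite-Q : Finite Q) (finite-I : Finite I) (q₀ : Q)
  (δₒ : Bool → Q → Bool → Q × Word × I)
  (δᵢ : I → Bool → Bool → I × Word)
  (final : I → Word)
  where

  runᵢ : I → List (Bool × Bool) → List Bool
  runᵢ i []             = letters (final i)
  runᵢ i ((b , p) ∷ ms) = letters (proj₂ (δᵢ i b p)) ++ runᵢ (proj₁ (δᵢ i b p)) ms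

  mark : List Bool → Bool → List Bool → List (Bool × Bool)
  mark l b r = map (_, false) l ++ (b , true) ∷ map (_, false) r

  runₒ : Bool → Q → List Bool → List Bool → List Bool
  runₒ φ q l []      = []
  runₒ φ q l (b ∷ r) =
    (letters (proj₁ (proj₂ (δₒ φ q b))) ++ runᵢ (proj₂ (proj₂ (δₒ φ q b))) (mark l b r)) ++
    runₒ φ (proj₁ (δₒ φ q b)) (l ++ b ∷ []) r

  transduce : List Bool → List Bool
  transduce x = runₒ false q₀ [] x ++ runₒ true q₀ [] x

  length-mark : ∀ l b r → length (mark l b r) ≡ length l + suc (length r)
  length-mark l b r = trans (length-++ (map (_, false) l))
    (cong₂ (λ m n → m + suc n) (length-map _ l) (length-map _ r))

  -- mk is the left end of the tape and end closes the output. In cell b p h, the flag p marks the outer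
  -- head and h the inner one; append runs to the end of the tape, after which return looks for a flag.
  data Cell : Set where
    mk end : Cell
    cell   : (b p h : Bool) → Cell

  P : Set
  P = Bool × Q

  -- Where the head has to return after an append: to the left end for `start` and `restart`, to the
  -- inner flag for `within`, to the outer flag for `finish`, to the cell that borders the output
  -- for `halt`.
  data Cont : Set where
    start   : P → I → Cont
    within  : P → I → Cont
    finish  : P → Cont
    restart : P → Cont
    halt    : Cont

  data State : Set where
    init   : Maybe Bool → State
    outer  : P → State
    inner  : P → I → State
    append : Word → Cont → State
    return : Cont → State
    done   : State

  -- Initialisation shifts the input one cell to the right to make room for `mk`; the state carries
  -- the cell that is still to be written.
  pending : Maybe Bool → Cell
  pending nothing  = mk
  pending (just b) = cell b false false

  nextPass : P → Cont
  nextPass (false , _) = restart (true , q₀)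
  nextPass (true  , _) = halt

  Action : Set
  Action = Maybe (State × Symbol Cell × Move)

  δ-init : Maybe Bool → Symbol Cell → Action
  δ-init m (bit b) = just (init (just b) , ext (pending m) , R)
  δ-init m blank   = just (append ε (restart (false , q₀)) , ext (pending m) , R)
  δ-init m (ext _) = nothing

  δ-outer : P → Symbol Cell → Action
  δ-outer (φ , q) (ext (cell b _ _)) =
    just ( append (proj₁ (proj₂ (δₒ φ q b))) (start (φ , proj₁ (δₒ φ q b)) (proj₂ (proj₂ (δₒ φ q b))))
         , ext (cell b true false) , R)
  -- Input cells are work symbols and the output consists of plain bits, so this case is reached
  -- just past the last input cell, at an output bit or at `end`.
  δ-outer q x = just (append ε (nextPass q) , x , S)

  δ-inner : P → I → Symbol Cell → Action
  δ-inner q i (ext (cell b p _)) =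
    just (append (proj₂ (δᵢ i b p)) (within q (proj₁ (δᵢ i b p))) , ext (cell b p true) , R)
  δ-inner q i x = just (append (final i) (finish q) , x , S)

  δ-write : Maybe (Bool × Word) → Cont → Action
  δ-write nothing        k = just (return k , ext end , L)
  δ-write (just (b , u)) k = just (append u k , bit b , R)

  δ-append : Word → Cont → Symbol Cell → Action
  δ-append u k blank     = δ-write (pop u) k
  δ-append u k (ext end) = δ-write (pop u) k
  δ-append u k x         = just (append u k , x , R)

  δ-return : Cont → Symbol Cell → Action
  δ-return (start q i)  (ext mk)                = just (inner q i , ext mk , R)
  δ-return (restart q)  (ext mk)                = just (outer q , ext mk , R)
  δ-return (within q i) (ext (cell b p true))   = just (inner q i , ext (cell b p false) , R)
  δ-return (finish q)   (ext (cell b true h))   = just (outer q , ext (cell b false h) , R)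
  -- The first work symbol on the way left borders the output, so one move to the right puts the
  -- head where `output` starts reading.
  δ-return halt         (ext e)                 = just (done , ext e , R)
  δ-return k            x                       = just (return k , x , L)

  δ : State → Symbol Cell → Action
  δ (init m)     = δ-init m
  δ (outer q)    = δ-outer q
  δ (inner q i)  = δ-inner q i
  δ (append u k) = δ-append u k
  δ (return k)   = δ-return k
  δ done         = λ _ → nothing

  finite-Cell : Finite Cell
  finite-Cell = finite-via (retract f g f-g)
    (finite-⊤ finite-⊎ finite-⊤ finite-⊎ finite-Bool finite-× finite-Bool finite-× finite-Bool)
    where
    f : Cell → ⊤ ⊎ ⊤ ⊎ Bool × Bool × Bool
    f mk           = inj₁ tt
    f end          = inj₂ (inj₁ tt)
    f (cell b p h) = inj₂ (inj₂ (b , p , h))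
    g : ⊤ ⊎ ⊤ ⊎ Bool × Bool × Bool → Cell
    g (inj₁ _)                  = mk
    g (inj₂ (inj₁ _))           = end
    g (inj₂ (inj₂ (b , p , h))) = cell b p h
    f-g : ∀ x → g (f x) ≡ x
    f-g mk           = refl
    f-g end          = refl
    f-g (cell b p h) = refl

  finite-P : Finite P
  finite-P = finite-Bool finite-× finite-Q

  finite-Cont : Finite Cont
  finite-Cont = finite-via (retract f g f-g)
    (finite-P finite-× finite-I finite-⊎ finite-P finite-× finite-I finite-⊎
     finite-P finite-⊎ finite-P finite-⊎ finite-⊤)
    where
    f : Cont → P × I ⊎ P × I ⊎ P ⊎ P ⊎ ⊤
    f (start q i)  = inj₁ (q , i)
    f (within q i) = inj₂ (inj₁ (q , i))
    f (finish q)   = inj₂ (inj₂ (inj₁ q))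
    f (restart q)  = inj₂ (inj₂ (inj₂ (inj₁ q)))
    f halt         = inj₂ (inj₂ (inj₂ (inj₂ tt)))
    g : P × I ⊎ P × I ⊎ P ⊎ P ⊎ ⊤ → Cont
    g (inj₁ (q , i))                = start q i
    g (inj₂ (inj₁ (q , i)))         = within q i
    g (inj₂ (inj₂ (inj₁ q)))        = finish q
    g (inj₂ (inj₂ (inj₂ (inj₁ q)))) = restart q
    g (inj₂ (inj₂ (inj₂ (inj₂ _)))) = halt
    f-g : ∀ x → g (f x) ≡ x
    f-g (start q i)  = refl
    f-g (within q i) = refl
    f-g (finish q)   = refl
    f-g (restart q)  = refl
    f-g halt         = refl

  finite-State : Finite State
  finite-State = finite-via (retract f g f-g)
    (finite-⊤ finite-⊎ finite-Bool finite-⊎ finite-P finite-⊎ finite-P finite-× finite-I finite-⊎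
     finite-Word finite-× finite-Cont finite-⊎ finite-Cont finite-⊎ finite-⊤)
    where
    T : Set
    T = ⊤ ⊎ Bool ⊎ P ⊎ P × I ⊎ Word × Cont ⊎ Cont ⊎ ⊤
    f : State → T
    f (init nothing)  = inj₁ tt
    f (init (just b)) = inj₂ (inj₁ b)
    f (outer q)       = inj₂ (inj₂ (inj₁ q))
    f (inner q i)     = inj₂ (inj₂ (inj₂ (inj₁ (q , i))))
    f (append u k)    = inj₂ (inj₂ (inj₂ (inj₂ (inj₁ (u , k)))))
    f (return k)      = inj₂ (inj₂ (inj₂ (inj₂ (inj₂ (inj₁ k)))))
    f done            = inj₂ (inj₂ (inj₂ (inj₂ (inj₂ (inj₂ tt)))))
    g : T → State
    g (inj₁ _)                                           = init nothing
    g (inj₂ (inj₁ b))                                    = init (just b)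
    g (inj₂ (inj₂ (inj₁ q)))                             = outer q
    g (inj₂ (inj₂ (inj₂ (inj₁ (q , i)))))                = inner q i
    g (inj₂ (inj₂ (inj₂ (inj₂ (inj₁ (u , k))))))         = append u k
    g (inj₂ (inj₂ (inj₂ (inj₂ (inj₂ (inj₁ k))))))        = return k
    g (inj₂ (inj₂ (inj₂ (inj₂ (inj₂ (inj₂ _))))))        = done
    f-g : ∀ x → g (f x) ≡ x
    f-g (init nothing)  = refl
    f-g (init (just b)) = refl
    f-g (outer q)       = refl
    f-g (inner q i)     = refl
    f-g (append u k)    = refl
    f-g (return k)      = refl
    f-g done            = refl

  -- Correctness and step counts of the simulating machine

  module Correctness {q g : ℕ} (State↪ : State ↪ Fin (suc q)) (Cell↪ : Cell ↪ Fin g) where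

    open Simulation State↪ Cell↪ δ public

    Passes : Cont → Symbol Cell → Set
    Passes k x = δ-return k x ≡ just (return k , x , L)

    Inside : Symbol Cell → Set
    Inside x = ∀ u k → δ-append u k x ≡ just (append u k , x , R)

    bits : List Bool → List (Symbol Cell)
    bits = map bit

    unmarked : Bool → Symbol Cell
    unmarked b = ext (cell b false false)

    marked : Bool × Bool → Symbol Cell
    marked (b , p) = ext (cell b p false)

    -- What can follow the output when a letter is due: the `end` left by the previous append, or
    -- nothing, at the very beginning and once that `end` has been overwritten by a bit.
    data Tip : List (Symbol Cell) → Set where
      fresh  : Tip []
      closed : Tip (ext end ∷ [])

    append-right : ∀ {u k} l r {ys} → All Inside r →
                   at (append u k) l (r ++ ys) ↝⟨ length r ⟩ at (append u k) (r ʳ++ l) ys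
    append-right l []      _        = ε
    append-right {u} {k} l (x ∷ r) (p ∷ ps) = step-R l (x ∷ r ++ _) (p u k) ◅ append-right (x ∷ l) r ps

    pop-[] : ∀ u → letters u ≡ [] → pop u ≡ nothing
    pop-[] ε              _ = refl
    pop-[] one            ()
    pop-[] (code zero)    ()
    pop-[] (code (suc k)) ()

    pop-∷ : ∀ u {b bs} → letters u ≡ b ∷ bs → ∃ λ v → pop u ≡ just (b , v) × letters v ≡ bs
    pop-∷ one            refl = ε , refl , refl
    pop-∷ (code zero)    refl = ε , refl , refl
    pop-∷ (code (suc k)) refl = code (inject₁ k) , refl , cong encℕ (toℕ-inject₁ k)

    δ-append-tip : ∀ {u k ys} → Tip ys → δ-append u k (head ys) ≡ δ-write (pop u) k
    δ-append-tip fresh  = refl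
    δ-append-tip closed = refl

    tail-tip : ∀ {ys} → Tip ys → tail ys ≡ []
    tail-tip fresh  = refl
    tail-tip closed = refl

    write : ∀ u {k} l {ys} bs → letters u ≡ bs → Tip ys →
            at (append u k) l ys ↝⟨ suc (length bs) ⟩
            before (return k) (bits bs ʳ++ l) (ext end ∷ [])
    write u {k} l {ys} [] eq tip = trans (step-L l ys δ≡) (cong (just ∘ before _ l ∘ (_ ∷_)) (tail-tip tip)) ◅ ε
      where
      δ≡ : δ-append u k (head ys) ≡ just (return k , ext end , L)
      δ≡ = trans (δ-append-tip tip) (cong (λ m → δ-write m k) (pop-[] u eq))
    write u {k} l {ys} (b ∷ bs) eq tip with pop-∷ u eq
    ... | v , pop≡ , eq′ = trans (step-R l ys δ≡) (cong (just ∘ at _ (bit b ∷ l)) (tail-tip tip)) ◅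
                           write v (bit b ∷ l) bs eq′ fresh
      where
      δ≡ : δ-append u k (head ys) ≡ just (append v k , bit b , R)
      δ≡ = trans (δ-append-tip tip) (cong (λ m → δ-write m k) pop≡)

    return-left : ∀ {k} zs l {r} → All (Passes k) zs →
                  before (return k) (zs ʳ++ l) r ↝⟨ length zs ⟩ before (return k) l (zs ++ r)
    return-left []       l _        = ε
    return-left (z ∷ zs) l (p ∷ ps) = return-left zs (z ∷ l) ps ▻◅ step-L l (z ∷ zs ++ _) p

    passes-bit : ∀ k b → Passes k (bit b)
    passes-bit (start _ _)  _ = refl
    passes-bit (within _ _) _ = refl
    passes-bit (finish _)   _ = refl
    passes-bit (restart _)  _ = refl
    passes-bit halt         _ = refl

    passes-bits : ∀ k bs → All (Passes k) (bits bs)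
    passes-bits k []       = []
    passes-bits k (b ∷ bs) = passes-bit k b ∷ passes-bits k bs

    inside-bits : ∀ bs → All Inside (bits bs)
    inside-bits []       = []
    inside-bits (_ ∷ bs) = (λ _ _ → refl) ∷ inside-bits bs

    inside-marked : ∀ ms → All Inside (map marked ms)
    inside-marked []       = []
    inside-marked (_ ∷ ms) = (λ _ _ → refl) ∷ inside-marked ms

    tape : List Bool → List (Symbol Cell)
    tape o = bits o ++ ext end ∷ []

    bits-tape : ∀ o w → bits o ++ tape w ≡ tape (o ++ w)
    bits-tape o w = sym (trans (cong (_++ _) (map-++ bit o w)) (++-assoc (bits o) (bits w) _))

    -- The way right crosses `b` input cells, `o` old and `u` new output bits and writes `end`; the
    -- way back crosses the same cells and `c` further ones to the left of the start.
    sweep-bound : ∀ {D} b o u c → c + b + (o + u) ≤ D →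
                  ((b + o) + suc u) + (u + (o + (b + c))) ≤ suc (D + D)
    sweep-bound {D} b o u c h = begin
      ((b + o) + suc u) + (u + (o + (b + c)))    ≡⟨ lemma b o u c ⟩
      suc ((b + (o + u)) + (c + b + (o + u)))    ≤⟨ s≤s (+-mono-≤ (≤-trans (+-monoˡ-≤ (o + u) (m≤n+m b c)) h) h) ⟩
      suc (D + D)                                ∎
      where
      open ≤-Reasoning
      lemma : ∀ b o u c → ((b + o) + suc u) + (u + (o + (b + c))) ≡ suc ((b + (o + u)) + (c + b + (o + u)))
      lemma = solve-∀

    -- The output grows by u and the head comes back to the symbol y at which k stops.
    roundtrip : ∀ {D} u {k} l y {y′ s} left right o →
      All (Passes k) left → All (Passes k) right → All Inside right →
      δ-return k y ≡ just (s , y′ , R) →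
      ∀ {ys} → Tip ys →
      length left + length right + (length o + length (letters u)) ≤ D →
      at (append u k) (left ʳ++ y ∷ l) (right ++ bits o ++ ys) ↝⟨ suc (suc (D + D)) ⟩
      at s (y′ ∷ l) (left ++ right ++ tape (o ++ letters u))
    roundtrip {D} u {k} l y {y′} {s} left right o pl pr ir stop {ys} tip bound =
      subst (λ z → at (append u k) (left ʳ++ y ∷ l) (right ++ bits o ++ ys) ↝⟨ suc (suc (D + D)) ⟩
                   at s (y′ ∷ l) (left ++ right ++ z))
        (bits-tape o (letters u))
        (weaken (s≤s bound′)
          (((append-right _ right ir ▻ append-right _ (bits o) (inside-bits o)) ▻
            write u _ (letters u) refl tip) ▻
           (return-left (bits (letters u)) _ (passes-bits k _) ▻
            (return-left (bits o) _ (passes-bits k o) ▻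
             (return-left right _ pr ▻ return-left left (y ∷ l) pl)))
           ▻◅ step-R l (y ∷ left ++ right ++ bits o ++ tape (letters u)) stop))
      where
      shape : ℕ → ℕ → ℕ
      shape b w = ((length right + b) + suc (length (letters u))) + (w + (b + (length right + length left)))
      bound′ : shape (length (bits o)) (length (bits (letters u))) ≤ suc (D + D)
      bound′ = subst₂ (λ b w → shape b w ≤ suc (D + D)) (sym (length-map bit o)) (sym (length-map bit (letters u)))
        (sweep-bound (length right) (length o) (length (letters u)) (length left) bound)

    -- One step that issues the append, then a `roundtrip` of at most 2D + 2 steps.
    callCost : ℕ → ℕ
    callCost D = suc (suc (suc (D + D)))

    passes-map : ∀ {A : Set} k (f : A → Symbol Cell) → (∀ x → Passes k (f x)) → ∀ xs → All (Passes k) (map f xs)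
    passes-map k f p xs = map⁺ (All.universal p xs)

    inner-tape : ∀ q i o → δ-inner q i (head (tape o)) ≡ just (append (final i) (finish q) , head (tape o) , S)
    inner-tape q i []      = refl
    inner-tape q i (_ ∷ _) = refl

    outer-tape : ∀ q o → δ-outer q (head (tape o)) ≡ just (append ε (nextPass q) , head (tape o) , S)
    outer-tape q []      = refl
    outer-tape q (_ ∷ _) = refl

    head∷tail-tape : ∀ o → head (tape o) ∷ tail (tape o) ≡ tape o
    head∷tail-tape []      = refl
    head∷tail-tape (_ ∷ _) = refl

    -- The equation locates the outer flag as seen from the right end of the row: `left` consists of
    -- the cells that `finish` crosses before meeting it. The bound counts the output still to come
    -- as well, so the same `D` serves every call. There is one call per cell and one for the
    -- `final` word.
    inner-loop : ∀ {D N} q i ms o l {l₀} left b →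
      map marked ms ʳ++ l ≡ left ʳ++ ext (cell b true false) ∷ l₀ →
      All (Passes (finish q)) left →
      length ms ≤ N → length left ≤ N → N + (length o + length (runᵢ i ms)) ≤ D →
      at (inner q i) l (map marked ms ++ tape o) ↝⟨ suc (length ms) * callCost D ⟩
      at (outer q) (unmarked b ∷ l₀) (left ++ tape (o ++ runᵢ i ms))
    inner-loop {D} q i [] o l left b refl pl _ left≤N bound =
      weaken (m≤m+n _ _)
        (trans (step-S l (tape o) (inner-tape q i o)) (cong (just ∘ at _ l) (head∷tail-tape o)) ◅
         roundtrip (final i) _ _ left [] o pl [] [] refl closed bound′)
      where
      bound′ : length left + 0 + (length o + length (letters (final i))) ≤ D
      bound′ = ≤-trans (+-monoˡ-≤ _ (≤-trans (≤-reflexive (+-identityʳ _)) left≤N)) bound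
    inner-loop {D} {N} q i (m@(b′ , p) ∷ ms) o l {l₀} left b eq pl ms<N left≤N bound =
      subst (λ z → at (inner q i) l (map marked (m ∷ ms) ++ tape o) ↝⟨ suc (length (m ∷ ms)) * callCost D ⟩
                   at (outer q) (unmarked b ∷ l₀) (left ++ tape z))
        (++-assoc o (letters w) rest)
        ((step-R l (marked m ∷ map marked ms ++ tape o) refl ◅
          roundtrip w _ _ [] (map marked ms) o [] (passes-map _ marked (λ _ → refl) ms) (inside-marked ms)
            refl closed bound₁) ▻
         inner-loop q i′ ms (o ++ letters w) (marked m ∷ l) left b eq pl (<⇒≤ ms<N) left≤N bound₂)
      where
      w    = proj₂ (δᵢ i b′ p)
      i′   = proj₁ (δᵢ i b′ p)
      rest = runᵢ i′ ms
      bound₁ : length (map marked ms) + (length o + length (letters w)) ≤ D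
      bound₁ = ≤-trans
        (+-mono-≤ (≤-trans (≤-reflexive (length-map marked ms)) (<⇒≤ ms<N))
          (+-monoʳ-≤ (length o) (≤-trans (m≤m+n _ _) (≤-reflexive (sym (length-++ (letters w)))))))
        bound
      bound₂ : N + (length (o ++ letters w) + length rest) ≤ D
      bound₂ = ≤-trans (≤-reflexive (cong (N +_) (begin
        length (o ++ letters w) + length rest            ≡⟨ cong (_+ length rest) (length-++ o) ⟩
        length o + length (letters w) + length rest      ≡⟨ +-assoc (length o) _ _ ⟩
        length o + (length (letters w) + length rest)    ≡⟨ cong (length o +_) (length-++ (letters w)) ⟨
        length o + length (letters w ++ rest)            ∎))) bound
        where open ≡-Reasoning

    map-marked-mark : ∀ l b r → map marked (mark l b r) ≡
                      map unmarked l ++ ext (cell b true false) ∷ map unmarked r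
    map-marked-mark l b r = trans (map-++ marked (map (_, false) l) _)
      (sym (cong₂ (λ l′ r′ → l′ ++ ext (cell b true false) ∷ r′) (map-∘ l) (map-∘ r)))

    bottom : List (Symbol Cell)
    bottom = ext mk ∷ []

    -- Each input cell costs `suc (suc N)` calls: one for the word of the outer transition and
    -- `suc N` for the inner scan.
    outer-loop : ∀ {D} N φ q l r o →
      length l + length r ≡ N → N + (length o + length (runₒ φ q l r)) ≤ D →
      ∃ λ q′ → at (outer (φ , q)) (map unmarked l ʳ++ bottom) (map unmarked r ++ tape o)
                 ↝⟨ length r * (suc (suc N) * callCost D) ⟩
               at (outer (φ , q′)) (map unmarked (l ++ r) ʳ++ bottom) (tape (o ++ runₒ φ q l r))
    outer-loop N φ q l [] o _ _ rewrite ++-identityʳ o | ++-identityʳ l = q , ε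
    outer-loop {D} N φ q l (b ∷ r) o N≡ bound =
      proj₁ ih , subst₂ (λ l′ z → at (outer (φ , q)) left (map unmarked (b ∷ r) ++ tape o)
                                    ↝⟨ suc (length r) * (suc (suc N) * callCost D) ⟩
                                  at (outer (φ , proj₁ ih)) (map unmarked l′ ʳ++ bottom) (tape z))
        (++-assoc l (b ∷ []) r) assoc
        (((step-R left (map unmarked (b ∷ r) ++ tape o) refl ◅ first) ▻ second) ▻ proj₂ ih)
      where
      u     = proj₁ (proj₂ (δₒ φ q b))
      i     = proj₂ (proj₂ (δₒ φ q b))
      q′    = proj₁ (δₒ φ q b)
      ms    = mark l b r
      w     = runᵢ i ms
      rest  = runₒ φ q′ (l ++ b ∷ []) r
      left  = map unmarked l ʳ++ bottom
      pivot = ext (cell b true false)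
      left⁺ = map unmarked l ++ pivot ∷ []

      assoc : ((o ++ letters u) ++ w) ++ rest ≡ o ++ (letters u ++ w) ++ rest
      assoc = trans (cong (_++ rest) (++-assoc o (letters u) w)) (++-assoc o _ rest)

      length-ms : length ms ≡ N
      length-ms = trans (length-mark l b r) N≡

      bound₃ : N + (length ((o ++ letters u) ++ w) + length rest) ≤ D
      bound₃ = ≤-trans (≤-reflexive (cong (N +_)
        (trans (sym (length-++ ((o ++ letters u) ++ w))) (trans (cong length assoc) (length-++ o))))) bound

      bound₂ : N + (length (o ++ letters u) + length w) ≤ D
      bound₂ = ≤-trans (+-monoʳ-≤ N (≤-trans (≤-reflexive (sym (length-++ (o ++ letters u)))) (m≤m+n _ _))) bound₃

      bound₁ : length left⁺ + length (map unmarked r) + (length o + length (letters u)) ≤ D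
      bound₁ = ≤-trans (+-mono-≤ (≤-reflexive length-row)
          (≤-trans (≤-reflexive (sym (length-++ o))) (m≤m+n _ _))) bound₂
        where
        length-row : length left⁺ + length (map unmarked r) ≡ N
        length-row = begin
          length left⁺ + length (map unmarked r)
            ≡⟨ cong₂ _+_ (length-++ (map unmarked l)) (length-map unmarked r) ⟩
          length (map unmarked l) + 1 + length r
            ≡⟨ cong (λ m → m + 1 + length r) (length-map unmarked l) ⟩
          length l + 1 + length r
            ≡⟨ +-assoc (length l) 1 _ ⟩
          length l + suc (length r)
            ≡⟨ N≡ ⟩
          N ∎
          where open ≡-Reasoning

      first : at (append u (start (φ , q′) i)) (pivot ∷ left) (map unmarked r ++ tape o) ↝⟨ suc (suc (D + D)) ⟩
              at (inner (φ , q′) i) bottom (map marked ms ++ tape (o ++ letters u))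
      first = subst₂ (λ x y → at (append u (start (φ , q′) i)) x (map unmarked r ++ tape o) ↝⟨ suc (suc (D + D)) ⟩
                              at (inner (φ , q′) i) bottom y)
        (++-ʳ++ (map unmarked l))
        (trans (sym (++-assoc left⁺ (map unmarked r) _))
          (cong (_++ tape (o ++ letters u))
            (trans (++-assoc (map unmarked l) _ _) (sym (map-marked-mark l b r)))))
        (roundtrip u [] (ext mk) left⁺ (map unmarked r) o
          (++⁺ (passes-map _ unmarked (λ _ → refl) l) (refl ∷ []))
          (passes-map _ unmarked (λ _ → refl) r)
          (map⁺ (All.universal (λ _ _ _ → refl) r)) refl closed bound₁)

      second : at (inner (φ , q′) i) bottom (map marked ms ++ tape (o ++ letters u)) ↝⟨ suc N * callCost D ⟩
               at (outer (φ , q′)) (map unmarked (l ++ b ∷ []) ʳ++ bottom)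
                  (map unmarked r ++ tape ((o ++ letters u) ++ w))
      second = subst₂ (λ m x → at (inner (φ , q′) i) bottom (map marked ms ++ tape (o ++ letters u)) ↝⟨ suc m * callCost D ⟩
                               at (outer (φ , q′)) x (map unmarked r ++ tape ((o ++ letters u) ++ w)))
        length-ms
        (sym (trans (cong (_ʳ++ bottom) (map-++ unmarked l (b ∷ []))) (++-ʳ++ (map unmarked l))))
        (inner-loop (φ , q′) i ms (o ++ letters u) bottom (map unmarked r) b
          (trans (cong (_ʳ++ bottom) (map-marked-mark l b r)) (++-ʳ++ (map unmarked l)))
          (passes-map _ unmarked (λ _ → refl) r)
          (≤-reflexive length-ms)
          (≤-trans (≤-reflexive (length-map unmarked r))
            (≤-trans (m≤n+m _ (length l)) (≤-trans (+-monoʳ-≤ (length l) (n≤1+n _)) (≤-reflexive N≡))))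
          bound₂)

      ih = outer-loop {D} N φ q′ (l ++ b ∷ []) r ((o ++ letters u) ++ w)
        (trans (cong (_+ length r) (length-++ l)) (trans (+-assoc (length l) 1 _) N≡)) bound₃

    initialise : ∀ m l x → at (init m) l (bits x) ↝⟨ suc (length x) ⟩
                 at (append ε (restart (false , q₀))) (map unmarked x ʳ++ ext (pending m) ∷ l) []
    initialise m l []      = step-R l [] refl ◅ ε
    initialise m l (b ∷ x) = step-R l (bits (b ∷ x)) refl ◅ initialise (just b) (ext (pending m) ∷ l) x

    -- Serves to name the cell to the left of the output, where `halt` stops: the last input cell,
    -- or `mk` if the input is empty.
    ʳ++-nonempty : ∀ {A : Set} (xs : List A) {y ys} {T : A → Set} → All T xs → T y →
                   ∃₂ λ z zs → T z × xs ʳ++ y ∷ ys ≡ z ∷ zs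
    ʳ++-nonempty []       _        t = _ , _ , t , refl
    ʳ++-nonempty (x ∷ xs) (p ∷ ps) _ = ʳ++-nonempty xs ps p

    readBits-tape : ∀ o → readBits (map encode (tape o)) ≡ o
    readBits-tape []      = refl
    readBits-tape (b ∷ o) = cong (b ∷_) (readBits-tape o)

    output-at : ∀ {s} l o → output (at s l (tape o)) ≡ o
    output-at l []      = refl
    output-at l (b ∷ o) = cong (b ∷_) (readBits-tape o)

    IsExt : Symbol Cell → Set
    IsExt x = ∃ λ e → x ≡ ext e

    end-of-pass : ∀ {D s} q l y {y′} left o →
      All (Passes (nextPass q)) left → δ-return (nextPass q) y ≡ just (s , y′ , R) →
      length left + length o ≤ D →
      at (outer q) (left ʳ++ y ∷ l) (tape o) ↝⟨ callCost D ⟩ at s (y′ ∷ l) (left ++ tape o)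
    end-of-pass {D} {s} q l y {y′} left o pl stop bound =
      subst (λ z → at (outer q) (left ʳ++ y ∷ l) (tape o) ↝⟨ callCost D ⟩ at s (y′ ∷ l) (left ++ tape z))
        (++-identityʳ o)
        (trans (step-S (left ʳ++ y ∷ l) (tape o) (outer-tape q o)) (cong (just ∘ at _ _) (head∷tail-tape o)) ◅
         roundtrip ε l y left [] o pl [] [] stop closed
           (≤-trans (≤-reflexive (cong₂ _+_ (+-identityʳ (length left)) (+-identityʳ (length o)))) bound))

    scanCost : ℕ → ℕ → ℕ
    scanCost N D = N * (suc (suc N) * callCost D) + callCost D

    totalCost : ℕ → ℕ → ℕ
    totalCost N D = suc N + (suc (suc (D + D)) + (scanCost N D + scanCost N D))

    computation : ∀ {D} x → length x + length (transduce x) ≤ D →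
      ∃₂ λ y l → at (init nothing) [] (bits x) ↝⟨ totalCost (length x) D ⟩ at done (y ∷ l) (tape (transduce x))
    computation {D} x bound
      with outer-loop {D} (length x) false q₀ [] x [] refl bound₁
         | outer-loop {D} (length x) true q₀ [] x (runₒ false q₀ [] x) refl bound₂
         | ʳ++-nonempty (map unmarked x) {ext mk} {[]} {T = IsExt} (map⁺ (All.universal (λ _ → _ , refl) x)) (_ , refl)
      where
      N = length x
      o₁ = runₒ false q₀ [] x
      o₂ = runₒ true q₀ [] x
      bound₂ : N + (length o₁ + length o₂) ≤ D
      bound₂ = ≤-trans (≤-reflexive (cong (N +_) (sym (length-++ o₁)))) bound
      bound₁ : N + length o₁ ≤ D
      bound₁ = ≤-trans (+-monoʳ-≤ N (m≤m+n _ _)) bound₂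
    ... | q₁ , pass₁ | q₂ , pass₂ | _ , l , (e , refl) , bottom≡ = ext e , l ,
      initialise nothing [] x ▻
      begin-pass ▻
      (pass₁ ▻ end-of-pass (false , q₁) [] (ext mk) (map unmarked x) o₁
                 (passes-map _ unmarked (λ _ → refl) x) refl bound₁) ▻
      (pass₂ ▻ subst (λ z → at (outer (true , q₂)) z (tape (o₁ ++ o₂)) ↝⟨ callCost D ⟩
                           at done (ext e ∷ l) (tape (o₁ ++ o₂)))
        (sym bottom≡)
        (end-of-pass (true , q₂) l (ext e) [] (o₁ ++ o₂) [] refl (≤-trans (m≤n+m _ _) bound)))
      where
      o₁ = runₒ false q₀ [] x
      o₂ = runₒ true q₀ [] x
      length-x : length (map unmarked x) ≡ length x
      length-x = length-map unmarked x
      bound₁ : length (map unmarked x) + length o₁ ≤ D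
      bound₁ = ≤-trans (+-mono-≤ (≤-reflexive length-x) (≤-trans (m≤m+n _ _) (≤-reflexive (sym (length-++ o₁))))) bound
      -- Appending the empty word writes the first `end` and brings the head back to `mk`.
      begin-pass : at (append ε (restart (false , q₀))) (map unmarked x ʳ++ bottom) [] ↝⟨ suc (suc (D + D)) ⟩
                   at (outer (false , q₀)) bottom (map unmarked x ++ tape [])
      begin-pass = roundtrip ε [] (ext mk) (map unmarked x) [] [] (passes-map _ unmarked (λ _ → refl) x) [] [] refl fresh
        (≤-trans (+-monoˡ-≤ 0 (≤-reflexive (+-identityʳ _))) (≤-trans (+-monoʳ-≤ _ z≤n) bound₁))

  -- Output length and running time

  length-runᵢ : ∀ i ms → length (runᵢ i ms) ≤ suc (length ms) * 4
  length-runᵢ i []             = length-letters (final i)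
  length-runᵢ i ((b , p) ∷ ms) = begin
    length (letters (proj₂ (δᵢ i b p)) ++ runᵢ _ ms)         ≡⟨ length-++ (letters (proj₂ (δᵢ i b p))) ⟩
    length (letters (proj₂ (δᵢ i b p))) + length (runᵢ _ ms) ≤⟨ +-mono-≤ (length-letters (proj₂ (δᵢ i b p))) (length-runᵢ _ ms) ⟩
    suc (suc (length ms)) * 4                                ∎
    where open ≤-Reasoning

  length-runₒ : ∀ N φ q l r → length l + length r ≡ N → length (runₒ φ q l r) ≤ length r * (suc (suc N) * 4)
  length-runₒ N φ q l []      _  = z≤n
  length-runₒ N φ q l (b ∷ r) N≡ = begin
    length ((u ++ w) ++ rest)             ≡⟨ length-++ (u ++ w) ⟩
    length (u ++ w) + length rest         ≡⟨ cong (_+ length rest) (length-++ u) ⟩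
    length u + length w + length rest     ≤⟨ +-mono-≤ (+-mono-≤ (length-letters (proj₁ (proj₂ (δₒ φ q b)))) length-w)
                                               (length-runₒ N φ _ (l ++ b ∷ []) r N≡′) ⟩
    4 + suc N * 4 + length r * (suc (suc N) * 4) ∎
    where
    open ≤-Reasoning
    u    = letters (proj₁ (proj₂ (δₒ φ q b)))
    w    = runᵢ (proj₂ (proj₂ (δₒ φ q b))) (mark l b r)
    rest = runₒ φ (proj₁ (δₒ φ q b)) (l ++ b ∷ []) r
    N≡′ : length (l ++ b ∷ []) + length r ≡ N
    N≡′ = trans (cong (_+ length r) (length-++ l)) (trans (+-assoc (length l) 1 _) N≡)
    length-w : length w ≤ suc N * 4
    length-w = ≤-trans (length-runᵢ _ (mark l b r))
      (≤-reflexive (cong (λ m → suc m * 4) (trans (length-mark l b r) N≡)))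

  -- This is (N + 1)^2, with the product N (N + 2) kept visible because a pass makes N + 2 appends
  -- for each of the N cells.
  square : ℕ → ℕ
  square N = suc (N * suc (suc N))

  n<square : ∀ N → suc N ≤ square N
  n<square N = s≤s (m≤m*n N (suc (suc N)))

  -- The 9 is 1 for the input and 4 for each of the two passes, a word having at most 4 letters.
  length-transduce : ∀ x → length x + length (transduce x) ≤ 9 * square (length x)
  length-transduce x = begin
    N + length (transduce x)                                    ≡⟨ cong (N +_) (length-++ (runₒ false q₀ [] x)) ⟩
    N + (length (runₒ false q₀ [] x) + length (runₒ true q₀ [] x))
      ≤⟨ +-mono-≤ (≤-trans (n≤1+n N) (n<square N))
           (+-mono-≤ (length-runₒ N false q₀ [] x refl) (length-runₒ N true q₀ [] x refl)) ⟩
    square N + (N * (suc (suc N) * 4) + N * (suc (suc N) * 4))  ≤⟨ m≤m+n _ 8 ⟩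
    square N + (N * (suc (suc N) * 4) + N * (suc (suc N) * 4)) + 8 ≡⟨ lemma N ⟩
    9 * square N                                                ∎
    where
    open ≤-Reasoning
    N = length x
    lemma : ∀ N → suc (N * (2 + N)) + (N * ((2 + N) * 4) + N * ((2 + N) * 4)) + 8 ≡ 9 * suc (N * (2 + N))
    lemma = solve-∀

  module _ {q g : ℕ} (State↪ : State ↪ Fin (suc q)) (Cell↪ : Cell ↪ Fin g)
           (start≡0 : to State↪ (init nothing) ≡ zero) where

    open Correctness State↪ Cell↪

    -- With s = `square N` the cost is at most 36 s² + 25 s + 2, and 36 + 25 + 2 = 63. The slack
    -- added below is 27 s² - 25 s - 2, rewritten in s - 1 = N (N + 2) so that no subtraction
    -- occurs.
    cost-bound : ∀ N → totalCost N (9 * square N) ≤ 63 * (square N * square N)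
    cost-bound N = begin
      totalCost N (9 * square N)
        ≤⟨ +-monoˡ-≤ _ (n<square N) ⟩
      square N + (suc (suc (9 * square N + 9 * square N)) + (scanCost N (9 * square N) + scanCost N (9 * square N)))
        ≤⟨ m≤m+n _ (29 * (N * (2 + N)) + 27 * ((N * (2 + N)) * (N * (2 + N)))) ⟩
      square N + (suc (suc (9 * square N + 9 * square N)) + (scanCost N (9 * square N) + scanCost N (9 * square N)))
        + (29 * (N * (2 + N)) + 27 * ((N * (2 + N)) * (N * (2 + N))))
        ≡⟨ lemma N ⟩
      63 * (square N * square N) ∎
      where
      open ≤-Reasoning
      lemma : ∀ N → suc (N * (2 + N)) + (2 + (9 * suc (N * (2 + N)) + 9 * suc (N * (2 + N))) +
                ((N * ((2 + N) * (3 + (9 * suc (N * (2 + N)) + 9 * suc (N * (2 + N))))) + (3 + (9 * suc (N * (2 + N)) + 9 * suc (N * (2 + N))))) +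
                 (N * ((2 + N) * (3 + (9 * suc (N * (2 + N)) + 9 * suc (N * (2 + N))))) + (3 + (9 * suc (N * (2 + N)) + 9 * suc (N * (2 + N)))))))
                + (29 * (N * (2 + N)) + 27 * ((N * (2 + N)) * (N * (2 + N))))
              ≡ 63 * (suc (N * (2 + N)) * suc (N * (2 + N)))
      lemma = solve-∀

    -- For N ≥ 1, N + 1 ≤ 2N gives (N + 1)^4 ≤ 16 N^4; the summand 16 covers N = 0.
    square²-bound : ∀ N → square N * square N ≤ 16 * N ^ 4 + 16
    square²-bound zero    = s≤s z≤n
    square²-bound N@(suc M) = begin
      square N * square N                          ≡⟨ lemma₁ M ⟩
      (2 + M) * (2 + M) * ((2 + M) * (2 + M))      ≤⟨ *-mono-≤ (*-mono-≤ le le) (*-mono-≤ le le) ⟩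
      (2 * N) * (2 * N) * ((2 * N) * (2 * N))      ≡⟨ lemma₂ N ⟩
      16 * N ^ 4                                   ≤⟨ m≤m+n _ 16 ⟩
      16 * N ^ 4 + 16                              ∎
      where
      open ≤-Reasoning
      le : 2 + M ≤ 2 * N
      le = ≤-trans (m≤m+n (2 + M) M) (≤-reflexive (lemma M))
        where
        lemma : ∀ M → 2 + M + M ≡ 2 * (1 + M)
        lemma = solve-∀
      lemma₁ : ∀ M → suc ((1 + M) * (3 + M)) * suc ((1 + M) * (3 + M)) ≡ (2 + M) * (2 + M) * ((2 + M) * (2 + M))
      lemma₁ = solve-∀
      lemma₂ : ∀ N → (2 * N) * (2 * N) * ((2 * N) * (2 * N)) ≡ 16 * (N * (N * (N * (N * 1))))
      lemma₂ = solve-∀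

    time-bound : ∀ N → totalCost N (9 * square N) ≤ 1008 * N ^ 4 + 1008
    time-bound N = begin
      totalCost N (9 * square N)     ≤⟨ cost-bound N ⟩
      63 * (square N * square N)     ≤⟨ *-monoʳ-≤ 63 (square²-bound N) ⟩
      63 * (16 * N ^ 4 + 16)         ≡⟨ *-distribˡ-+ 63 (16 * N ^ 4) 16 ⟩
      63 * (16 * N ^ 4) + 1008       ≡⟨ cong (_+ 1008) (*-assoc 63 16 (N ^ 4)) ⟨
      1008 * N ^ 4 + 1008            ∎
      where open ≤-Reasoning

    polyTime-machine : PolyTime transduce
    polyTime-machine = machine , 1008 , 4 , λ x →
      let y , l , run = computation x (length-transduce x) in
      _ , ≤-refl , at done (y ∷ l) (tape (transduce x)) ,
      trans (cong (runFor machine (1008 * length x ^ 4 + 1008)) (initConfig-at x start≡0))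
        (runFor-halts (weaken (time-bound (length x)) run) (step-halt (y ∷ l) (tape (transduce x)) refl)) ,
      output-at {done} (y ∷ l) (transduce x)

  transduce-polyTime : PolyTime transduce
  -- `init nothing` is the first summand in `finite-State`, so its number computes to 0 and the
  -- number of states is visibly a successor.
  transduce-polyTime = polyTime-machine (proj₂ finite-State) (proj₂ finite-Cell) refl

-- The outer states parse the encoding of a circuit; c₂ also keeps the parity of the constant read so
-- far. The terms of a gate come from its bits: a unit of c1 and the start of a MOD₂ gate yield constant
-- terms; the end of c2 yields the coefficient and the circuit part of a product term, and the end of the
-- same gate the rest of its exponent vector. The first pass writes q for each gate, the second 2q.
data Q : Set where
  first vars c₀ gates c₁ ins exps exp stop : Q
  c₂ : Bool → Q

-- dense writes a whole exponent vector, prefix one without the entries of the block 1ⁿ, and await the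
-- parities of the exponents listed after the marked position.
data I : Set where
  header dense await items prefix : I
  say  : Word → I
  item : Bool → I

-- The units of ℤ₃ as signs, `true` being 2 = -1, so that products become `xor`. In pass `φ`
-- everything is multiplied by `coef φ`; hence `coef (not φ)` is the factor 2 of the gate value
-- times the factor of the pass.
coef : Bool → Fin 3
coef false = 1F
coef true  = 2F

idle : Q → Q × Word × I
idle q = q , ε , say ε

headerIf : Bool → I
headerIf false = header
headerIf true  = say ε

-- The words are fragments of the code of the instance: `code (suc c)` opens a term with coefficient
-- `c`, `one` opens a polynomial, `code 0F` closes a list, and `code 1F` is a whole empty polynomial
-- together with the bit announcing it.
δₒ : Bool → Q → Bool → Q × Word × I
δₒ φ     first  true  = vars , ε , headerIf φ
δₒ φ     first  false = c₀ , ε , headerIf φ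
δₒ φ     vars   true  = idle vars
δₒ φ     vars   false = idle c₀
δₒ false c₀     true  = c₀ , code 1F , say ε
δₒ true  c₀     true  = idle c₀
δₒ φ     c₀     false = idle gates
-- The summand 1 of 1 + α^q + α^{2q} is written here, in the first pass only.
δₒ false gates  true  = c₁ , code 1F , say one
δₒ true  gates  true  = c₁ , ε , say one
δₒ false gates  false = idle stop
δₒ true  gates  false = stop , ε , say (code 0F)
δₒ φ     c₁     true  = c₁ , code (suc (coef φ)) , dense
δₒ φ     c₁     false = idle ins
δₒ φ     ins    true  = c₂ false , code (suc (coef (not φ))) , dense
δₒ φ     ins    false = gates , ε , say (code 0F)
δₒ φ     (c₂ e) true  = idle (c₂ (not e))
δₒ φ     (c₂ e) false = exps , code (suc (coef (not φ xor e))) , await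
δₒ φ     exps   true  = idle exp
δₒ φ     exps   false = ins , ε , prefix
δₒ φ     exp    true  = idle exp
δₒ φ     exp    false = idle exps
δₒ φ     stop   _     = idle stop

-- The words 10 and 1110: the bit announcing an entry, then the exponent 0 or 2.
markedEntry : Bool → Word
markedEntry false = code 1F
markedEntry true  = code 3F

-- A product term takes two inner scans, since a scan moves only to the right: `items` reads
-- exponents that lie behind the marked position, whereas the entries of the extra variables start
-- at the 0 that ends the block 1ⁿ, before it.
δᵢ : I → Bool → Bool → I × Word
δᵢ header   _     _     = header , one
δᵢ dense    _     p     = dense , markedEntry p
δᵢ await    _     false = await , ε
δᵢ await    _     true  = items , ε
δᵢ items    true  _     = item false , ε
δᵢ items    false _     = say ε , ε
δᵢ (item e) true  _     = item (not e) , ε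
δᵢ (item e) false _     = items , code (suc (if e then 1F else 0F))
δᵢ prefix   true  _     = prefix , ε
-- The first 0 ends the block 1ⁿ and is itself the first position with an extra variable, so its
-- entry is written already here.
δᵢ prefix   false p     = dense , markedEntry p
δᵢ (say w)  _     _     = say w , ε

final : I → Word
final header  = code 0F
final dense   = code 0F
final (say w) = w
final _       = ε

finite-Q : Finite Q
finite-Q = finite-via (retract f g f-g) (finite-Bool finite-⊎ finite-Fin 9)
  where
  f : Q → Bool ⊎ Fin 9
  f (c₂ e) = inj₁ e
  f first  = inj₂ 0F
  f vars   = inj₂ 1F
  f c₀     = inj₂ 2F
  f gates  = inj₂ 3F
  f c₁     = inj₂ 4F
  f ins    = inj₂ 5F
  f exps   = inj₂ 6F
  f exp    = inj₂ 7F
  f stop   = inj₂ 8F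
  g : Bool ⊎ Fin 9 → Q
  g (inj₁ e)  = c₂ e
  g (inj₂ 0F) = first
  g (inj₂ 1F) = vars
  g (inj₂ 2F) = c₀
  g (inj₂ 3F) = gates
  g (inj₂ 4F) = c₁
  g (inj₂ 5F) = ins
  g (inj₂ 6F) = exps
  g (inj₂ 7F) = exp
  g (inj₂ 8F) = stop
  f-g : ∀ x → g (f x) ≡ x
  f-g (c₂ e) = refl
  f-g first  = refl
  f-g vars   = refl
  f-g c₀     = refl
  f-g gates  = refl
  f-g c₁     = refl
  f-g ins    = refl
  f-g exps   = refl
  f-g exp    = refl
  f-g stop   = refl

finite-I : Finite I
finite-I = finite-via (retract f g f-g) (finite-Word finite-⊎ finite-Bool finite-⊎ finite-Fin 5)
  where
  f : I → Word ⊎ Bool ⊎ Fin 5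
  f (say w)  = inj₁ w
  f (item e) = inj₂ (inj₁ e)
  f header   = inj₂ (inj₂ 0F)
  f dense    = inj₂ (inj₂ 1F)
  f await    = inj₂ (inj₂ 2F)
  f items    = inj₂ (inj₂ 3F)
  f prefix   = inj₂ (inj₂ 4F)
  g : Word ⊎ Bool ⊎ Fin 5 → I
  g (inj₁ w) = say w
  g (inj₂ (inj₁ e)) = item e
  g (inj₂ (inj₂ 0F)) = header
  g (inj₂ (inj₂ 1F)) = dense
  g (inj₂ (inj₂ 2F)) = await
  g (inj₂ (inj₂ 3F)) = items
  g (inj₂ (inj₂ 4F)) = prefix
  f-g : ∀ x → g (f x) ≡ x
  f-g (say w)  = refl
  f-g (item e) = refl
  f-g header   = refl
  f-g dense    = refl
  f-g await    = refl
  f-g items    = refl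
  f-g prefix   = refl

-- Encoded lists and the outputs of the inner scans

open NestedTransducer finite-Q finite-I first δₒ δᵢ final
  using (runᵢ; runₒ; mark; transduce; transduce-polyTime)

-- An encoded list without its closing bit: the contribution of a stretch of the scan to a list that
-- a later stretch continues.
encEntries : {A : Set} → (A → List Bool) → List A → List Bool
encEntries f []       = []
encEntries f (x ∷ xs) = true ∷ f x ++ encEntries f xs

encEntries-++ : {A : Set} (f : A → List Bool) (xs ys : List A) →
                encEntries f (xs ++ ys) ≡ encEntries f xs ++ encEntries f ys
encEntries-++ f []       ys = refl
encEntries-++ f (x ∷ xs) ys = cong (true ∷_) (trans (cong (f x ++_) (encEntries-++ f xs ys)) (sym (++-assoc (f x) _ _)))

encList-++ : {A : Set} (f : A → List Bool) (xs ys : List A) →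
             encList f (xs ++ ys) ≡ encEntries f xs ++ encList f ys
encList-++ f []       ys = refl
encList-++ f (x ∷ xs) ys = cong (true ∷_) (trans (cong (f x ++_) (encList-++ f xs ys)) (sym (++-assoc (f x) _ _)))

encList-entries : {A : Set} (f : A → List Bool) (xs : List A) → encList f xs ≡ encEntries f xs ++ false ∷ []
encList-entries f xs = trans (cong (encList f) (sym (++-identityʳ xs))) (encList-++ f xs [])

ones : ℕ → List Bool
ones n = replicate n true

parity : ℕ → Bool
parity zero    = false
parity (suc n) = not (parity n)

reduced : ℕ → Fin 3
reduced e = if parity e then 1F else 0F

-- The junk value for o ≥ K is the zero vector.
unit : ∀ K → ℕ → Vec (Fin 3) K
unit zero    _       = []
unit (suc K) zero    = 2F ∷ Vec.replicate K 0F
unit (suc K) (suc o) = 0F ∷ unit K o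

plain : List Bool → List (Bool × Bool)
plain = map (_, false)

run-say : ∀ w ms → runᵢ (say w) ms ≡ letters w
run-say w []       = refl
run-say w (_ ∷ ms) = run-say w ms

run-header : ∀ ms → runᵢ header ms ≡ encℕ (length ms)
run-header []       = refl
run-header (_ ∷ ms) = cong (true ∷_) (run-header ms)

run-dense-plain : ∀ xs → runᵢ dense (plain xs) ≡ encVec (encFin {3}) (Vec.replicate (length xs) 0F)
run-dense-plain []       = refl
run-dense-plain (_ ∷ xs) = cong (λ w → true ∷ false ∷ w) (run-dense-plain xs)

run-dense-unit : ∀ l b r → runᵢ dense (mark l b r) ≡ encVec encFin (unit (length (l ++ b ∷ r)) (length l))
run-dense-unit []      b r = cong (λ w → true ∷ true ∷ true ∷ false ∷ w) (run-dense-plain r)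
run-dense-unit (_ ∷ l) b r = cong (λ w → true ∷ false ∷ w) (run-dense-unit l b r)

run-dense : ∀ n l b r → runᵢ dense (mark (ones n ++ l) b r) ≡
            encVec encFin (Vec.replicate n 0F Vec.++ unit (length (l ++ b ∷ r)) (length l))
run-dense zero    l b r = run-dense-unit l b r
run-dense (suc n) l b r = cong (λ w → true ∷ false ∷ w) (run-dense n l b r)

run-prefix : ∀ n l b r → runᵢ prefix (mark (ones n ++ false ∷ l) b r) ≡
             encVec encFin (unit (length (false ∷ l ++ b ∷ r)) (length (false ∷ l)))
run-prefix zero    l b r = cong (λ w → true ∷ false ∷ w) (run-dense-unit l b r)
run-prefix (suc n) l b r = run-prefix n l b r

run-item : ∀ e k r → runᵢ (item e) (plain (encℕ k ++ r)) ≡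
           true ∷ encFin {3} (if e xor parity k then 1F else 0F) ++ runᵢ items (plain r)
run-item false zero    r = refl
run-item true  zero    r = refl
run-item false (suc k) r = trans (run-item true k r) refl
run-item true  (suc k) r = trans (run-item false k r)
  (cong (λ p → true ∷ encFin {3} (if p then 1F else 0F) ++ runᵢ items (plain r)) (sym (not-involutive (parity k))))

run-items : ∀ es r → runᵢ items (plain (encList encℕ es ++ r)) ≡ encEntries encFin (map reduced es)
run-items []       r = run-say ε (plain r)
run-items (e ∷ es) r = begin
  runᵢ (item false) (plain ((encℕ e ++ encList encℕ es) ++ r))
    ≡⟨ cong (runᵢ (item false) ∘ plain) (++-assoc (encℕ e) _ r) ⟩
  runᵢ (item false) (plain (encℕ e ++ encList encℕ es ++ r))
    ≡⟨ run-item false e _ ⟩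
  true ∷ encFin (reduced e) ++ runᵢ items (plain (encList encℕ es ++ r))
    ≡⟨ cong (λ w → true ∷ encFin (reduced e) ++ w) (run-items es r) ⟩
  true ∷ encFin (reduced e) ++ encEntries encFin (map reduced es) ∎
  where open ≡-Reasoning

run-await : ∀ l b r → runᵢ await (mark l b r) ≡ runᵢ items (plain r)
run-await []      b r = refl
run-await (_ ∷ l) b r = run-await l b r

-- The polynomials and the outer scan of an encoded circuit

module Reduction (n : ℕ) (suffix : List Bool) where

  K : ℕ
  K = length suffix

  constTerm : Fin 3 → ℕ → Term (n + K)
  constTerm c o = c , Vec.replicate n 0F Vec.++ unit K o

  prodTerm : Fin 3 → Vec ℕ n → ℕ → Term (n + K)
  prodTerm c e o = c , Vec.map reduced e Vec.++ unit K o

  c₁Terms : Bool → ℕ → ℕ → Poly (n + K)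
  c₁Terms φ o zero    = []
  c₁Terms φ o (suc k) = constTerm (coef φ) o ∷ c₁Terms φ (suc o) k

  insTerms : Bool → ℕ → List (Mod2Gate n) → Poly (n + K)
  insTerms φ o []                  = []
  insTerms φ o (g@(mod2 c e) ∷ gs) =
    constTerm (coef (not φ)) o ∷
    -- `encMod2 g` starts at the offset after `o`, so this is the offset of its last bit, where the
    -- exponent vector gets completed.
    prodTerm (coef (not φ xor parity c)) e (o + length (encMod2 g)) ∷
    insTerms φ (suc (o + length (encMod2 g))) gs

  gatePoly : Bool → ℕ → Mod3Gate n → Poly (n + K)
  gatePoly φ o (mod3 c gs) = c₁Terms φ (suc o) c ++ insTerms φ (suc o + length (encℕ c)) gs

  addGate : Bool → Poly (n + K) → List (Poly (n + K)) → List (Poly (n + K))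
  addGate false p ps = [] ∷ p ∷ ps
  addGate true  p ps = p ∷ ps

  gatePolys : Bool → ℕ → List (Mod3Gate n) → List (Poly (n + K))
  gatePolys φ o []       = []
  gatePolys φ o (g ∷ gs) = addGate φ (gatePoly φ o g) (gatePolys φ (suc o + length (encMod3 g)) gs)

  -- `past` says that the head is beyond the 0 that ends the block 1ⁿ. The inner state `prefix`
  -- recognises this 0 as the first one, and `run-prefix` is stated for marks to the right of it.
  record Position (o : ℕ) (l r : List Bool) : Set where
    constructor position
    field
      offset : length l ≡ o
      split  : l ++ r ≡ suffix
      past   : ∃ λ l′ → l ≡ false ∷ l′

  advance : ∀ {o l} xs {r} → Position o l (xs ++ r) → Position (o + length xs) (l ++ xs) r
  advance {l = l} xs (position off spl (l′ , refl)) =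
    position (trans (length-++ l) (cong (_+ length xs) off)) (trans (++-assoc l xs _) spl) (l′ ++ xs , refl)

  advance₁ : ∀ {o l b r} → Position o l (b ∷ r) → Position (suc o) (l ++ b ∷ []) r
  advance₁ {o} {l} {b} {r} p = subst (λ m → Position m (l ++ b ∷ []) r) (+-comm o 1) (advance (b ∷ []) p)

  reassoc : ∀ {o l} xs {ys r} → Position o l ((xs ++ ys) ++ r) → Position o l (xs ++ ys ++ r)
  reassoc xs {ys} {r} = subst (Position _ _) (++-assoc xs ys r)

  -- A Hoare-style triple for the outer scan. Both contexts `l` and `r` are recorded because the
  -- inner scans started on `xs` read the entire input.
  record Scan (φ : Bool) (q : Q) (l xs r w : List Bool) (q′ : Q) : Set where
    constructor scan
    field
      scanned : runₒ φ q (ones n ++ l) (xs ++ r) ≡ w ++ runₒ φ q′ (ones n ++ l ++ xs) r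

  open Scan public

  scan-++ : ∀ {φ q q′ q″ l} xs {ys r w v} →
            Scan φ q l xs (ys ++ r) w q′ → Scan φ q′ (l ++ xs) ys r v q″ → Scan φ q l (xs ++ ys) r (w ++ v) q″
  scan-++ {φ} {q} {q′} {q″} {l} xs {ys} {r} {w} {v} (scan s) (scan t) = scan (begin
    runₒ φ q (ones n ++ l) ((xs ++ ys) ++ r)               ≡⟨ cong (runₒ φ q _) (++-assoc xs ys r) ⟩
    runₒ φ q (ones n ++ l) (xs ++ ys ++ r)                 ≡⟨ s ⟩
    w ++ runₒ φ q′ (ones n ++ l ++ xs) (ys ++ r)           ≡⟨ cong (w ++_) t ⟩
    w ++ v ++ runₒ φ q″ (ones n ++ (l ++ xs) ++ ys) r      ≡⟨ ++-assoc w v _ ⟨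
    (w ++ v) ++ runₒ φ q″ (ones n ++ (l ++ xs) ++ ys) r    ≡⟨ cong (λ z → (w ++ v) ++ runₒ φ q″ (ones n ++ z) r) (++-assoc l xs ys) ⟩
    (w ++ v) ++ runₒ φ q″ (ones n ++ l ++ xs ++ ys) r      ∎)
    where open ≡-Reasoning

  scan₁ : ∀ {φ q} l b {r q′ u i v} → δₒ φ q b ≡ (q′ , u , i) →
          runᵢ i (mark (ones n ++ l) b r) ≡ v → Scan φ q l (b ∷ []) r (letters u ++ v) q′
  scan₁ {φ} l b {r} {q′} {u} {v = v} refl refl =
    scan (cong (λ z → (letters u ++ v) ++ runₒ φ q′ z r) (++-assoc (ones n) l (b ∷ [])))

  scan-say : ∀ {φ q} l b {r q′ u w} → δₒ φ q b ≡ (q′ , u , say w) →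
             Scan φ q l (b ∷ []) r (letters u ++ letters w) q′
  scan-say l b {r} {w = w} eq = scan₁ l b eq (run-say w (mark (ones n ++ l) b r))

  dense-at : ∀ {o l b r} → Position o l (b ∷ r) →
             runᵢ dense (mark (ones n ++ l) b r) ≡ encVec encFin (Vec.replicate n 0F Vec.++ unit K o)
  dense-at {l = l} {b} {r} (position refl refl _) = run-dense n l b r

  prefix-at : ∀ {o l b r} → Position o l (b ∷ r) →
              runᵢ prefix (mark (ones n ++ l) b r) ≡ encVec encFin (unit K o)
  prefix-at {b = b} {r} (position refl refl (l , refl)) = run-prefix n l b r

  scan-c₁ : ∀ φ {o l} k {r} → Position o l (encℕ k ++ r) →
            Scan φ c₁ l (encℕ k) r (encEntries encTerm (c₁Terms φ o k)) ins
  scan-c₁ φ {l = l} zero    p = scan-say l false refl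
  scan-c₁ φ {l = l} (suc k) p =
    scan-++ (true ∷ []) (scan₁ l true refl (dense-at p)) (scan-c₁ φ k (advance₁ p))

  -- The exponents lie behind the stretch scanned, yet their parities are emitted: the inner scan
  -- reads ahead from the last bit of the constant. The parity `e` accumulated so far is general for
  -- the sake of the induction on `k`.
  scan-c₂ : ∀ φ e {o l} k es {r} → Position o l (encℕ k ++ encList encℕ es ++ r) →
            Scan φ (c₂ e) l (encℕ k) (encList encℕ es ++ r)
              (true ∷ encFin (coef (not φ xor (e xor parity k))) ++ encEntries encFin (map reduced es)) exps
  scan-c₂ φ e {l = l} zero es {r} p rewrite xor-identityʳ e =
    scan₁ l false refl (trans (run-await (ones n ++ l) false _) (run-items es r))
  scan-c₂ φ e {l = l} (suc k) es p =
    subst (λ z → Scan φ (c₂ e) l _ _ (true ∷ encFin (coef (not φ xor z)) ++ encEntries encFin (map reduced es)) exps)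
      (flip-parity e (parity k))
      (scan-++ (true ∷ []) (scan-say l true refl) (scan-c₂ φ (not e) k es (advance₁ p)))
    where
    flip-parity : ∀ a b → not a xor b ≡ a xor not b
    flip-parity false b = refl
    flip-parity true  b = sym (not-involutive b)

  scan-exp : ∀ φ {l} k {r} → Scan φ exp l (encℕ k) r [] exps
  scan-exp φ {l} zero    = scan-say l false refl
  scan-exp φ {l} (suc k) = scan-++ (true ∷ []) (scan-say l true refl) (scan-exp φ k)

  -- Output occurs only at the closing bit of the list, and the equation makes `m` the offset of
  -- that bit.
  scan-exps : ∀ φ {o l m} es {r} → Position o l (encList encℕ es ++ r) → suc m ≡ o + length (encList encℕ es) →
              Scan φ exps l (encList encℕ es) r (encVec encFin (unit K m)) ins
  scan-exps φ {o} {l} {m} [] p eq = scan₁ l false refl (trans (prefix-at p) (cong (encVec encFin ∘ unit K) o≡m))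
    where
    o≡m : o ≡ m
    o≡m = suc-injective (trans (+-comm 1 o) (sym eq))
  scan-exps φ {o} {l} {m} (e ∷ es) {r} p eq =
    scan-++ (true ∷ []) (scan-say l true refl)
      (scan-++ (encℕ e) (scan-exp φ e)
        (scan-exps φ es (advance (encℕ e) (reassoc (encℕ e) (advance₁ p))) eq′))
    where
    eq′ : suc m ≡ suc o + length (encℕ e) + length (encList encℕ es)
    eq′ = trans eq (trans (+-suc o _) (trans (cong (λ z → suc (o + z)) (length-++ (encℕ e))) (sym (+-assoc (suc o) (length (encℕ e)) _))))

  scan-ins : ∀ φ {o l} gs {r} → Position o l (encList encMod2 gs ++ r) →
             Scan φ ins l (encList encMod2 gs) r (encList encTerm (insTerms φ o gs)) gates
  scan-ins φ {o} {l} [] p = scan-say l false refl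
  scan-ins φ {o} {l} (g@(mod2 c e) ∷ gs) {r} p =
    subst (λ w → Scan φ ins l (encList encMod2 (g ∷ gs)) r w gates) assembled
      (scan-++ (true ∷ [])
        (scan₁ l true refl (dense-at p))
        (scan-++ (encMod2 g)
          (scan-++ (encℕ c) (scan-c₂ φ false c (toList e) p₂) (scan-exps φ (toList e) (advance (encℕ c) p₂) end≡))
          (scan-ins φ gs (advance (encMod2 g) p₁))))
    where
    p₁ : Position (suc o) (l ++ true ∷ []) (encMod2 g ++ encList encMod2 gs ++ r)
    p₁ = reassoc (encMod2 g) (advance₁ p)
    p₂ : Position (suc o) (l ++ true ∷ []) (encℕ c ++ encVec encℕ e ++ encList encMod2 gs ++ r)
    p₂ = reassoc (encℕ c) p₁
    m : ℕ
    m = o + length (encMod2 g)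
    end≡ : suc m ≡ suc o + length (encℕ c) + length (encVec encℕ e)
    end≡ = cong suc (trans (cong (o +_) (length-++ (encℕ c))) (sym (+-assoc o _ _)))
    rest : List Bool
    rest = encList encTerm (insTerms φ (suc m) gs)
    k : Fin 3
    k = coef (not φ xor parity c)
    -- The halves of the exponent vector, emitted at two different positions, join to one code
    -- because the first half lacks the closing bit.
    product≡ : encEntries encFin (map reduced (toList e)) ++ encVec encFin (unit K m) ≡
               encVec encFin (Vec.map reduced e Vec.++ unit K m)
    product≡ = begin
      encEntries encFin (map reduced (toList e)) ++ encVec encFin (unit K m)
        ≡⟨ encList-++ encFin (map reduced (toList e)) _ ⟨
      encList encFin (map reduced (toList e) ++ toList (unit K m))
        ≡⟨ cong (λ z → encList encFin (z ++ toList (unit K m))) (Vec.toList-map reduced e) ⟨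
      encList encFin (toList (Vec.map reduced e) ++ toList (unit K m))
        ≡⟨ cong (encList encFin) (Vec.toList-++ (Vec.map reduced e) _) ⟨
      encVec encFin (Vec.map reduced e Vec.++ unit K m) ∎
      where open ≡-Reasoning
    t₁ : List Bool
    t₁ = encVec encFin (Vec.replicate n 0F Vec.++ unit K o)
    assembled : (true ∷ encFin (coef (not φ)) ++ t₁) ++
                ((true ∷ encFin k ++ encEntries encFin (map reduced (toList e))) ++ encVec encFin (unit K m)) ++ rest ≡
                encList encTerm (insTerms φ o (g ∷ gs))
    assembled = cong (λ z → (true ∷ encFin (coef (not φ)) ++ t₁) ++ true ∷ z ++ rest)
      (trans (++-assoc (encFin k) _ _) (cong (encFin k ++_) product≡))

  opening : Bool → List Bool
  opening false = true ∷ false ∷ []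
  opening true  = []

  -- Both passes write into one list of polynomials, which the second pass closes.
  closing : Bool → List Bool
  closing false = []
  closing true  = false ∷ []

  scan-gate-start : ∀ φ {l r} → Scan φ gates l (true ∷ []) r (opening φ ++ true ∷ []) c₁
  scan-gate-start false {l} = scan-say l true refl
  scan-gate-start true  {l} = scan-say l true refl

  encPolys : List (Poly (n + K)) → List Bool
  encPolys = encEntries (encList encTerm)

  encPolys-addGate : ∀ φ p ps → encPolys (addGate φ p ps) ≡ (opening φ ++ true ∷ []) ++ encList encTerm p ++ encPolys ps
  encPolys-addGate false p ps = refl
  encPolys-addGate true  p ps = refl

  scan-gates : ∀ φ {o l} gs {r} → Position o l (encList encMod3 gs ++ r) →
               Scan φ gates l (encList encMod3 gs) r (encPolys (gatePolys φ o gs) ++ closing φ) stop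
  scan-gates false {l = l} [] p = scan-say l false refl
  scan-gates true  {l = l} [] p = scan-say l false refl
  scan-gates φ {o} {l} (g@(mod3 c gs₂) ∷ gs) {r} p =
    subst (λ w → Scan φ gates l (encList encMod3 (g ∷ gs)) r w stop) assembled
      (scan-++ (true ∷ []) (scan-gate-start φ)
        (scan-++ (encMod3 g)
          (scan-++ (encℕ c) (scan-c₁ φ c p₂) (scan-ins φ gs₂ (advance (encℕ c) p₂)))
          (scan-gates φ gs (advance (encMod3 g) p₁))))
    where
    p₁ : Position (suc o) (l ++ true ∷ []) (encMod3 g ++ encList encMod3 gs ++ r)
    p₁ = reassoc (encMod3 g) (advance₁ p)
    p₂ : Position (suc o) (l ++ true ∷ []) (encℕ c ++ encList encMod2 gs₂ ++ encList encMod3 gs ++ r)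
    p₂ = reassoc (encℕ c) p₁
    rest : List (Poly (n + K))
    rest = gatePolys φ (suc o + length (encMod3 g)) gs
    terms₁ terms₂ : Poly (n + K)
    terms₁ = c₁Terms φ (suc o) c
    terms₂ = insTerms φ (suc o + length (encℕ c)) gs₂
    assembled : (opening φ ++ true ∷ []) ++
                (encEntries encTerm terms₁ ++ encList encTerm terms₂) ++
                encPolys rest ++ closing φ ≡
                encPolys (gatePolys φ o (g ∷ gs)) ++ closing φ
    assembled = begin
      (opening φ ++ true ∷ []) ++ (encEntries encTerm terms₁ ++ encList encTerm terms₂) ++ encPolys rest ++ closing φ
        ≡⟨ cong (λ z → (opening φ ++ true ∷ []) ++ z ++ encPolys rest ++ closing φ) (encList-++ encTerm terms₁ terms₂) ⟨
      (opening φ ++ true ∷ []) ++ encList encTerm (gatePoly φ o g) ++ encPolys rest ++ closing φ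
        ≡⟨ cong ((opening φ ++ true ∷ []) ++_) (++-assoc (encList encTerm (gatePoly φ o g)) _ _) ⟨
      (opening φ ++ true ∷ []) ++ (encList encTerm (gatePoly φ o g) ++ encPolys rest) ++ closing φ
        ≡⟨ ++-assoc (opening φ ++ true ∷ []) _ _ ⟨
      ((opening φ ++ true ∷ []) ++ encList encTerm (gatePoly φ o g) ++ encPolys rest) ++ closing φ
        ≡⟨ cong (_++ closing φ) (encPolys-addGate φ (gatePoly φ o g) rest) ⟨
      encPolys (gatePolys φ o (g ∷ gs)) ++ closing φ ∎
      where open ≡-Reasoning

  c₀Polys : Bool → ℕ → List (Poly (n + K))
  c₀Polys false c = replicate c []
  c₀Polys true  c = []

  scan-c₀ : ∀ φ {l} c {r} → Scan φ c₀ l (encℕ c) r (encPolys (c₀Polys φ c)) gates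
  scan-c₀ false {l} zero    = scan-say l false refl
  scan-c₀ true  {l} zero    = scan-say l false refl
  scan-c₀ false {l} (suc c) = scan-++ (true ∷ []) (scan-say l true refl) (scan-c₀ false c)
  scan-c₀ true  {l} (suc c) = scan-++ (true ∷ []) (scan-say l true refl) (scan-c₀ true c)

run-vars : ∀ φ l k r → runₒ φ vars l (encℕ k ++ r) ≡ runₒ φ c₀ (l ++ encℕ k) r
run-vars φ l zero    r = cong (_++ runₒ φ c₀ _ r) (run-say ε (mark l false r))
run-vars φ l (suc k) r = trans (cong (_++ runₒ φ vars _ (encℕ k ++ r)) (run-say ε (mark l true (encℕ k ++ r))))
  (trans (run-vars φ (l ++ true ∷ []) k r) (cong (λ z → runₒ φ c₀ z r) (++-assoc l _ _)))

headerWord : Bool → ℕ → List Bool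
headerWord false N = encℕ N
headerWord true  N = []

length-mark-[] : ∀ b (r : List Bool) → length ((b , true) ∷ plain r) ≡ suc (length r)
length-mark-[] b r = cong suc (length-map _ r)

run-headerIf : ∀ φ b r → runᵢ (headerIf φ) (mark [] b r) ≡ headerWord φ (suc (length r))
run-headerIf false b r = trans (run-header (mark [] b r)) (cong encℕ (length-mark-[] b r))
run-headerIf true  b r = run-say ε (mark [] b r)

run-first : ∀ φ n r → runₒ φ first [] (encℕ n ++ r) ≡
            headerWord φ (length (encℕ n ++ r)) ++ runₒ φ c₀ (encℕ n) r
run-first φ zero    r = cong (_++ runₒ φ c₀ _ r) (run-headerIf φ false r)
run-first φ (suc n) r = cong₂ _++_ (run-headerIf φ true (encℕ n ++ r)) (run-vars φ (true ∷ []) n r)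

encℕ-ones : ∀ n → encℕ n ≡ ones n ++ false ∷ []
encℕ-ones zero    = refl
encℕ-ones (suc n) = cong (true ∷_) (encℕ-ones n)

-- The reduction and its code

body : Circuit → List Bool
body (circuit n c gs) = encℕ c ++ encList encMod3 gs

reduction : Circuit → PolyInstance
reduction C@(circuit n c gs) = polyInstance (n + K) (replicate c [] ++ gatePolys false o gs ++ gatePolys true o gs)
  where
  open Reduction n (false ∷ body C)
  -- The gate list follows the 0 that ends the block 1ⁿ and the code of `c`.
  o : ℕ
  o = suc (length (encℕ c))

transduce-encCircuit : ∀ C → transduce (encCircuit C) ≡ encInstance (reduction C)
transduce-encCircuit C@(circuit n c gs) = begin
  transduce (encCircuit C)
    ≡⟨ cong₂ _++_ (pass false) (pass true) ⟩
  (headerWord false N ++ (encPolys (c₀Polys false c) ++ encPolys (gatePolys false o gs) ++ []) ++ []) ++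
  (encPolys (gatePolys true o gs) ++ false ∷ []) ++ []
    ≡⟨ cong₂ _++_ (cong (headerWord false N ++_)
         (trans (++-identityʳ _) (cong (encPolys (c₀Polys false c) ++_) (++-identityʳ _)))) (++-identityʳ _) ⟩
  (encℕ N ++ encPolys (replicate c []) ++ encPolys (gatePolys false o gs)) ++
  encPolys (gatePolys true o gs) ++ false ∷ []
    ≡⟨ cong (λ z → (encℕ N ++ encPolys (replicate c []) ++ encPolys (gatePolys false o gs)) ++ z)
         (encList-entries _ (gatePolys true o gs)) ⟨
  (encℕ N ++ encPolys (replicate c []) ++ encPolys (gatePolys false o gs)) ++ encList (encList encTerm) (gatePolys true o gs)
    ≡⟨ ++-assoc (encℕ N) _ _ ⟩
  encℕ N ++ (encPolys (replicate c []) ++ encPolys (gatePolys false o gs)) ++ encList (encList encTerm) (gatePolys true o gs)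
    ≡⟨ cong (encℕ N ++_) (++-assoc (encPolys (replicate c [])) _ _) ⟩
  encℕ N ++ encPolys (replicate c []) ++ encPolys (gatePolys false o gs) ++ encList (encList encTerm) (gatePolys true o gs)
    ≡⟨ cong (λ z → encℕ N ++ encPolys (replicate c []) ++ z) (encList-++ _ (gatePolys false o gs) _) ⟨
  encℕ N ++ encPolys (replicate c []) ++ encList (encList encTerm) (gatePolys false o gs ++ gatePolys true o gs)
    ≡⟨ cong (encℕ N ++_) (encList-++ _ (replicate c []) _) ⟨
  encℕ N ++ encList (encList encTerm) (replicate c [] ++ gatePolys false o gs ++ gatePolys true o gs)
    ≡⟨ cong (λ z → encℕ z ++ encList (encList encTerm) (replicate c [] ++ gatePolys false o gs ++ gatePolys true o gs)) N≡ ⟩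
  encInstance (reduction C) ∎
  where
  open ≡-Reasoning
  open Reduction n (false ∷ body C)
  N o : ℕ
  N = length (encCircuit C)
  o = suc (length (encℕ c))
  N≡ : N ≡ n + K
  N≡ = begin
    length (encℕ n ++ body C)                      ≡⟨ cong (λ z → length (z ++ body C)) (encℕ-ones n) ⟩
    length ((ones n ++ false ∷ []) ++ body C)      ≡⟨ cong length (++-assoc (ones n) _ _) ⟩
    length (ones n ++ false ∷ body C)              ≡⟨ length-++ (ones n) ⟩
    length (ones n) + K                            ≡⟨ cong (_+ K) (length-replicate n) ⟩
    n + K                                          ∎
  pass : ∀ φ → runₒ φ first [] (encCircuit C) ≡
         headerWord φ N ++ (encPolys (c₀Polys φ c) ++ encPolys (gatePolys φ o gs) ++ closing φ) ++ []
  pass φ = trans (run-first φ n (body C)) (cong (headerWord φ N ++_) (trans (cong₂ (runₒ φ c₀) (encℕ-ones n) (sym (++-identityʳ (body C))))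
    (scanned (scan-++ (encℕ c) (scan-c₀ φ c) (scan-gates φ gs
      (position refl (cong (false ∷_) (trans (cong (encℕ c ++_) (++-identityʳ _)) refl)) (encℕ c , refl)))))))

-- Prefix-free codes

PrefixFree : {A : Set} → (A → List Bool) → Set
PrefixFree f = ∀ x y {s t} → f x ++ s ≡ f y ++ t → x ≡ y × s ≡ t

encℕ-prefixFree : PrefixFree encℕ
encℕ-prefixFree zero    zero    eq = refl , ∷-injectiveʳ eq
encℕ-prefixFree (suc m) (suc n) eq with encℕ-prefixFree m n (∷-injectiveʳ eq)
... | refl , eq′ = refl , eq′

encFin-prefixFree : ∀ {k} → PrefixFree (encFin {k})
encFin-prefixFree i j eq with encℕ-prefixFree (toℕ i) (toℕ j) eq
... | i≡j , eq′ = toℕ-injective i≡j , eq′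

encList-prefixFree : {A : Set} {f : A → List Bool} → PrefixFree f → PrefixFree (encList f)
encList-prefixFree pf []       []       eq = refl , ∷-injectiveʳ eq
encList-prefixFree {f = f} pf (x ∷ xs) (y ∷ ys) {s} {t} eq
  with pf x y (trans (sym (++-assoc (f x) (encList f xs) s)) (trans (∷-injectiveʳ eq) (++-assoc (f y) (encList f ys) t)))
... | refl , eq′ with encList-prefixFree pf xs ys eq′
...   | refl , eq″ = refl , eq″

toList-injective : ∀ {A : Set} {n} (xs ys : Vec A n) → toList xs ≡ toList ys → xs ≡ ys
toList-injective []       []       _    = refl
toList-injective (x ∷ xs) (y ∷ ys) eq with ∷-injective eq
... | refl , eq′ = cong (x ∷_) (toList-injective xs ys eq′)

encTerm-prefixFree : ∀ {n} → PrefixFree (encTerm {n})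
encTerm-prefixFree (c , e) (c′ , e′) {s} {t} eq
  with encFin-prefixFree c c′ (trans (sym (++-assoc (encFin c) _ s)) (trans eq (++-assoc (encFin c′) _ t)))
... | refl , eq′ with encList-prefixFree encFin-prefixFree (toList e) (toList e′) eq′
...   | e≡ , eq″ = cong (c ,_) (toList-injective e e′ e≡) , eq″

-- `PolyZeroLang` only provides some instance with the given code; injectivity identifies it with
-- the instance constructed by the reduction.
encInstance-injective : ∀ I J → encInstance I ≡ encInstance J → I ≡ J
encInstance-injective (polyInstance m ps) (polyInstance n qs) eq with encℕ-prefixFree m n eq
... | refl , eq′ = cong (polyInstance m) (proj₁
  (encList-prefixFree (encList-prefixFree encTerm-prefixFree) ps qs (cong (_++ []) eq′)))

-- Validity

-- The entry 2 at the smaller offset tells the vectors apart, even where the larger offset yields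
-- the junk value.
unit-distinct : ∀ {K o o′} → o < o′ → o < K → unit K o ≢ unit K o′
unit-distinct {suc K} {zero}  {suc o′} _         _         ()
unit-distinct {suc K} {suc o} {suc o′} (s≤s o<o′) (s≤s o<K) eq = unit-distinct o<o′ o<K (Vec.∷-injectiveʳ eq)

coef≢0 : ∀ φ → coef φ ≢ 0F
coef≢0 false ()
coef≢0 true  ()

length-encℕ>0 : ∀ k → 1 ≤ length (encℕ k)
length-encℕ>0 zero    = s≤s z≤n
length-encℕ>0 (suc k) = s≤s z≤n

module _ (n : ℕ) (suffix : List Bool) where

  open Reduction n suffix

  MarkedFrom : ℕ → Term (n + K) → Set
  MarkedFrom o t = ∃₂ λ (h : Vec (Fin 3) n) o′ → o ≤ o′ × proj₂ t ≡ h Vec.++ unit K o′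

  -- Polynomials are built from the back, with decreasing offsets; the lower bound on the marks
  -- present is what makes the next monomial new.
  Fresh : ℕ → Poly (n + K) → Set
  Fresh o p = ValidPoly p × All (MarkedFrom o) p

  fresh-[] : ∀ {o} → Fresh o []
  fresh-[] = ([] , []) , []

  fresh-∷ : ∀ {o o′ p} φ h → o < o′ → o < K → Fresh o′ p → Fresh o ((coef φ , h Vec.++ unit K o) ∷ p)
  fresh-∷ {o} {o′} φ h o<o′ o<K ((nonzero , unique) , marked) =
    (coef≢0 φ ∷ nonzero , map⁺ (All.map (λ {t} → distinct {t}) marked) ∷ unique) ,
    (h , o , ≤-refl , refl) ∷ All.map (λ (h′ , m , le , eq) → h′ , m , ≤-trans (<⇒≤ o<o′) le , eq) marked
    where
    distinct : ∀ {t} → MarkedFrom o′ t → h Vec.++ unit K o ≢ proj₂ t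
    distinct (h′ , m , le , refl) eq = unit-distinct (<-≤-trans o<o′ le) o<K (Vec.++-injectiveʳ h h′ eq)

  fresh-c₁ : ∀ φ {o} k {p} → o + k ≤ K → Fresh (o + k) p → Fresh o (c₁Terms φ o k ++ p)
  fresh-c₁ φ {o} zero    le fr = subst (λ m → Fresh m _) (+-identityʳ o) fr
  fresh-c₁ φ {o} (suc k) {p} le fr = fresh-∷ φ _ ≤-refl (≤-trans (m≤m+n (suc o) k) le′)
    (fresh-c₁ φ k le′ (subst (λ m → Fresh m p) (+-suc o k) fr))
    where
    le′ : suc o + k ≤ K
    le′ = subst (_≤ K) (+-suc o k) le

  fresh-ins : ∀ φ {o} gs → o + length (encList encMod2 gs) ≤ K → Fresh o (insTerms φ o gs)
  fresh-ins φ []                       le = fresh-[]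
  fresh-ins φ {o} (g@(mod2 c e) ∷ gs) le =
    fresh-∷ (not φ) _ o<m (<-trans o<m m<K)
      (fresh-∷ (not φ xor parity c) _ ≤-refl m<K (fresh-ins φ gs le′))
    where
    m : ℕ
    m = o + length (encMod2 g)
    le′ : suc m + length (encList encMod2 gs) ≤ K
    le′ = subst (_≤ K) (trans (cong (λ z → o + suc z) (length-++ (encMod2 g)))
      (trans (+-suc o _) (cong suc (sym (+-assoc o _ _))))) le
    m<K : m < K
    m<K = ≤-trans (m≤m+n (suc m) _) le′
    o<m : o < m
    o<m = subst (_≤ m) (+-comm o 1) (+-monoʳ-≤ o
      (≤-trans (length-encℕ>0 c) (≤-trans (m≤m+n _ _) (≤-reflexive (sym (length-++ (encℕ c)))))))

  valid-gate : ∀ φ o g → suc o + length (encMod3 g) ≤ K → ValidPoly (gatePoly φ o g)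
  valid-gate φ o (mod3 c gs) le = proj₁ (fresh-c₁ φ c
      (≤-trans (+-monoʳ-≤ (suc o) (≤-trans (n≤1+n c) (≤-reflexive (sym (length-encℕ c))))) (≤-trans (m≤m+n _ _) le′))
      (weaken-fresh (fresh-ins φ gs le′)))
    where
    le′ : suc o + length (encℕ c) + length (encList encMod2 gs) ≤ K
    le′ = subst (_≤ K) (trans (cong (suc o +_) (length-++ (encℕ c))) (sym (+-assoc (suc o) _ _))) le
    -- The closing bit of `encℕ c` yields no term, which leaves a gap of one between the two
    -- offsets.
    weaken-fresh : ∀ {p} → Fresh (suc o + length (encℕ c)) p → Fresh (suc o + c) p
    weaken-fresh (valid , marked) = valid , All.map
      (λ (h , m , le , eq) → h , m , ≤-trans (+-monoʳ-≤ (suc o) (≤-trans (n≤1+n c) (≤-reflexive (sym (length-encℕ c))))) le , eq)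
      marked

  valid-gates : ∀ φ o gs → o + length (encList encMod3 gs) ≤ K → All ValidPoly (gatePolys φ o gs)
  valid-gates φ o []       le = []
  valid-gates φ o (g ∷ gs) le = add φ (valid-gate φ o g (≤-trans (m≤m+n _ _) le′)) (valid-gates φ _ gs le′)
    where
    le′ : suc o + length (encMod3 g) + length (encList encMod3 gs) ≤ K
    le′ = subst (_≤ K) (trans (cong (λ z → o + suc z) (length-++ (encMod3 g)))
      (trans (+-suc o _) (cong suc (sym (+-assoc o _ _))))) le
    add : ∀ φ {p ps} → ValidPoly p → All ValidPoly ps → All ValidPoly (addGate φ p ps)
    add false v vs = ([] , []) ∷ v ∷ vs
    add true  v vs = v ∷ vs

reduction-valid : ∀ C → ValidInstance (reduction C)
reduction-valid C@(circuit n c gs) = ++⁺ (replicate⁺ c ([] , []))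
  (++⁺ (valid-gates n _ false _ gs le) (valid-gates n _ true _ gs le))
  where
  le : suc (length (encℕ c)) + length (encList encMod3 gs) ≤ suc (length (encℕ c ++ encList encMod3 gs))
  le = ≤-reflexive (cong suc (sym (length-++ (encℕ c))))

-- Arithmetic modulo 3

infix 4 _≈_

record _≈_ (m n : ℕ) : Set where
  constructor congruent
  field
    %-≡ : m % 3 ≡ n % 3

open _≈_

≈-refl : ∀ {m} → m ≈ m
≈-refl = congruent refl

≈-trans : ∀ {l m n} → l ≈ m → m ≈ n → l ≈ n
≈-trans (congruent p) (congruent q) = congruent (trans p q)

≈-reflexive : ∀ {m n} → m ≡ n → m ≈ n
≈-reflexive p = congruent (cong (_% 3) p)

+-cong : ∀ {a b c d} → a ≈ b → c ≈ d → a + c ≈ b + d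
+-cong {a} {b} {c} {d} (congruent p) (congruent q) = congruent
  (trans (%-distribˡ-+ a c 3) (trans (cong₂ (λ x y → (x + y) % 3) p q) (sym (%-distribˡ-+ b d 3))))

*-cong : ∀ {a b c d} → a ≈ b → c ≈ d → a * c ≈ b * d
*-cong {a} {b} {c} {d} (congruent p) (congruent q) = congruent
  (trans (%-distribˡ-* a c 3) (trans (cong₂ (λ x y → (x * y) % 3) p q) (sym (%-distribˡ-* b d 3))))

mod-cong : ∀ {m n} → m ≈ n → m mod 3 ≡ n mod 3
mod-cong {m} {n} (congruent p) = toℕ-injective (trans (toℕ-fromℕ< (m%n<n m 3)) (trans p (sym (toℕ-fromℕ< (m%n<n n 3)))))

parity-+ : ∀ m n → parity (m + n) ≡ parity m xor parity n
parity-+ zero    n = refl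
parity-+ (suc m) n = trans (cong not (parity-+ m n)) (not-distribˡ-xor (parity m) (parity n))

modGate-2 : ∀ k → modGate 2 k ≡ not (parity k)
modGate-2 zero          = refl
modGate-2 (suc zero)    = refl
modGate-2 (suc (suc k)) = trans (cong (_≡ᵇ 0) (trans (cong (_% 2) (+-comm 2 k)) ([m+n]%n≡m%n k 2)))
  (trans (modGate-2 k) (cong not (sym (not-involutive (parity k)))))

sign : Bool → ℕ
sign false = 1
sign true  = 2

sign-xor : ∀ a b → sign a * sign b ≈ sign (a xor b)
sign-xor false false = congruent refl
sign-xor false true  = congruent refl
sign-xor true  false = congruent refl
sign-xor true  true  = congruent refl

monomial : ∀ {n} → Vec (Fin 3) n → Vec Bool n → ℕ
monomial e a = product (toList (Vec.zipWith (λ em am → pm1 am ^ toℕ em) e a))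

monomial-++ : ∀ {m n} (e : Vec (Fin 3) m) (e′ : Vec (Fin 3) n) a a′ →
              monomial (e Vec.++ e′) (a Vec.++ a′) ≡ monomial e a * monomial e′ a′
monomial-++ []      e′ []      a′ = sym (*-identityˡ _)
monomial-++ (i ∷ e) e′ (b ∷ a) a′ = trans (cong (pm1 b ^ toℕ i *_) (monomial-++ e e′ a a′)) (sym (*-assoc (pm1 b ^ toℕ i) _ _))

monomial-zeros : ∀ {n} (a : Vec Bool n) → monomial (Vec.replicate n 0F) a ≡ 1
monomial-zeros []      = refl
monomial-zeros (b ∷ a) = trans (*-identityˡ _) (monomial-zeros a)

monomial-unit : ∀ K o (a : Vec Bool K) → monomial (unit K o) a ≈ 1
monomial-unit zero    o       []          = ≈-refl
monomial-unit (suc K) zero    (true ∷ a)  rewrite monomial-zeros a = ≈-refl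
monomial-unit (suc K) zero    (false ∷ a) rewrite monomial-zeros a = congruent refl
monomial-unit (suc K) (suc o) (b ∷ a)     rewrite *-identityˡ (monomial (unit K o) a) = monomial-unit K o a

exponentSum : ∀ {n} → Vec ℕ n → Vec Bool n → ℕ
exponentSum e y = sum (toList (Vec.zipWith (λ ei yi → ei * b2n yi) e y))

-- `not` reconciles two encodings: y_m = 1 means a_m = -1, which `pm1` reads from `false`. Exponents
-- matter only modulo 2 because (-1)^2 = 1.
factor : ∀ e y → pm1 (not y) ^ toℕ (reduced e) ≡ sign (parity (e * b2n y))
factor e false rewrite *-zeroʳ e with parity e
... | false = refl
... | true  = refl
factor e true rewrite *-identityʳ e with parity e
... | false = refl
... | true  = refl

monomial-reduced : ∀ {n} (e : Vec ℕ n) y → monomial (Vec.map reduced e) (Vec.map not y) ≈ sign (parity (exponentSum e y))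
monomial-reduced []       []       = ≈-refl
monomial-reduced (e ∷ es) (y ∷ ys) =
  ≈-trans (*-cong (≈-reflexive (factor e y)) (monomial-reduced es ys))
    (≈-trans (sign-xor (parity (e * b2n y)) (parity (exponentSum es ys)))
      (≈-reflexive (cong sign (sym (parity-+ (e * b2n y) (exponentSum es ys))))))

-- b = 2 + 2u in ℤ₃ for the value b of a MOD₂ gate and the corresponding sign u.
mod2-value : ∀ φ c s → toℕ (coef (not φ)) * 1 + toℕ (coef (not φ xor parity c)) * sign (parity s) ≈
             toℕ (coef φ) * b2n (modGate 2 (c + s))
mod2-value φ c s rewrite modGate-2 (c + s) | parity-+ c s = cases φ (parity c) (parity s)
  where
  cases : ∀ φ p q → toℕ (coef (not φ)) * 1 + toℕ (coef (not φ xor p)) * sign q ≈ toℕ (coef φ) * b2n (not (p xor q))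
  cases false false false = congruent refl
  cases false false true  = congruent refl
  cases false true  false = congruent refl
  cases false true  true  = congruent refl
  cases true  false false = congruent refl
  cases true  false true  = congruent refl
  cases true  true  false = congruent refl
  cases true  true  true  = congruent refl

-- Values of the polynomials modulo 3

module _ {n : ℕ} (suffix : List Bool) (y : Vec Bool n) (z : Vec Bool (length suffix)) where

  open Reduction n suffix

  a : Vec Bool (n + K)
  a = Vec.map not y Vec.++ z

  value : Poly (n + K) → ℕ
  value p = sum (map (evalTerm a) p)

  value-const : ∀ c o → evalTerm a (constTerm c o) ≈ toℕ c * 1
  value-const c o = *-cong (≈-refl {toℕ c})
    (≈-trans (≈-reflexive (trans (monomial-++ (Vec.replicate n 0F) (unit K o) (Vec.map not y) z)
                                 (cong (_* monomial (unit K o) z) (monomial-zeros (Vec.map not y)))))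
      (*-cong (≈-refl {1}) (monomial-unit K o z)))

  value-prod : ∀ c e o → evalTerm a (prodTerm c e o) ≈ toℕ c * sign (parity (exponentSum e y))
  value-prod c e o = *-cong (≈-refl {toℕ c})
    (≈-trans (≈-reflexive (monomial-++ (Vec.map reduced e) (unit K o) (Vec.map not y) z))
      (≈-trans (*-cong (monomial-reduced e y) (monomial-unit K o z)) (≈-reflexive (*-identityʳ _))))

  value-c₁ : ∀ φ o k → value (c₁Terms φ o k) ≈ toℕ (coef φ) * k
  value-c₁ φ o zero    = ≈-reflexive (sym (*-zeroʳ (toℕ (coef φ))))
  value-c₁ φ o (suc k) = ≈-trans (+-cong (value-const (coef φ) o) (value-c₁ φ (suc o) k))
    (≈-reflexive (sym (*-distribˡ-+ (toℕ (coef φ)) 1 k)))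

  value-ins : ∀ φ o gs → value (insTerms φ o gs) ≈ toℕ (coef φ) * sum (map (λ g → b2n (evalMod2 y g)) gs)
  value-ins φ o []                  = ≈-reflexive (sym (*-zeroʳ (toℕ (coef φ))))
  value-ins φ o (g@(mod2 c e) ∷ gs) =
    ≈-trans (≈-reflexive (sym (+-assoc t₁ t₂ _)))
      (≈-trans
        (+-cong (≈-trans (+-cong (value-const (coef (not φ)) o) (value-prod (coef (not φ xor parity c)) e _))
                         (mod2-value φ c (exponentSum e y)))
                (value-ins φ _ gs))
        (≈-reflexive (sym (*-distribˡ-+ (toℕ (coef φ)) (b2n (evalMod2 y g)) _))))
    where
    t₁ t₂ : ℕ
    t₁ = evalTerm a (constTerm (coef (not φ)) o)
    t₂ = evalTerm a (prodTerm (coef (not φ xor parity c)) e (o + length (encMod2 g)))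

  gateSum : Mod3Gate n → ℕ
  gateSum (mod3 c gs) = c + sum (map (λ g → b2n (evalMod2 y g)) gs)

  value-gate : ∀ φ o g → value (gatePoly φ o g) ≈ toℕ (coef φ) * gateSum g
  value-gate φ o (mod3 c gs) =
    ≈-trans (≈-reflexive (trans (cong sum (map-++ (evalTerm a) t₁ t₂)) (sum-++ (map (evalTerm a) t₁) _)))
      (≈-trans (+-cong (value-c₁ φ _ c) (value-ins φ _ gs))
        (≈-reflexive (sym (*-distribˡ-+ (toℕ (coef φ)) c _))))
    where
    t₁ t₂ : Poly (n + K)
    t₁ = c₁Terms φ (suc o) c
    t₂ = insTerms φ (suc o + length (encℕ c)) gs

-- The additive group of F4

-- Coordinates over the field of two elements in the basis 1, α. The laws of `⊕` are then inherited
-- from `xor`, without 64 cases for associativity.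
toBits : F4 → Bool × Bool
toBits 𝟘  = false , false
toBits 𝟙  = true , false
toBits α  = false , true
toBits α² = true , true

fromBits : Bool × Bool → F4
fromBits (false , false) = 𝟘
fromBits (true  , false) = 𝟙
fromBits (false , true)  = α
fromBits (true  , true)  = α²

fromBits-toBits : ∀ x → fromBits (toBits x) ≡ x
fromBits-toBits 𝟘  = refl
fromBits-toBits 𝟙  = refl
fromBits-toBits α  = refl
fromBits-toBits α² = refl

_⊕₂_ : Bool × Bool → Bool × Bool → Bool × Bool
(a , b) ⊕₂ (c , d) = a xor c , b xor d

toBits-⊕ : ∀ x y → toBits (x ⊕ y) ≡ toBits x ⊕₂ toBits y
toBits-⊕ 𝟘  y  = refl
toBits-⊕ 𝟙  𝟘  = refl
toBits-⊕ 𝟙  𝟙  = refl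
toBits-⊕ 𝟙  α  = refl
toBits-⊕ 𝟙  α² = refl
toBits-⊕ α  𝟘  = refl
toBits-⊕ α  𝟙  = refl
toBits-⊕ α  α  = refl
toBits-⊕ α  α² = refl
toBits-⊕ α² 𝟘  = refl
toBits-⊕ α² 𝟙  = refl
toBits-⊕ α² α  = refl
toBits-⊕ α² α² = refl

toBits-injective : ∀ {x y} → toBits x ≡ toBits y → x ≡ y
toBits-injective {x} {y} eq = trans (sym (fromBits-toBits x)) (trans (cong fromBits eq) (fromBits-toBits y))

⊕-assoc : ∀ x y z → (x ⊕ y) ⊕ z ≡ x ⊕ (y ⊕ z)
⊕-assoc x y z = toBits-injective (begin
  toBits ((x ⊕ y) ⊕ z)                   ≡⟨ toBits-⊕ (x ⊕ y) z ⟩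
  toBits (x ⊕ y) ⊕₂ toBits z             ≡⟨ cong (_⊕₂ toBits z) (toBits-⊕ x y) ⟩
  (toBits x ⊕₂ toBits y) ⊕₂ toBits z     ≡⟨ cong₂ _,_ (xor-assoc (proj₁ (toBits x)) _ _) (xor-assoc (proj₂ (toBits x)) _ _) ⟩
  toBits x ⊕₂ (toBits y ⊕₂ toBits z)     ≡⟨ cong (toBits x ⊕₂_) (toBits-⊕ y z) ⟨
  toBits x ⊕₂ toBits (y ⊕ z)             ≡⟨ toBits-⊕ x (y ⊕ z) ⟨
  toBits (x ⊕ (y ⊕ z))                   ∎)
  where open ≡-Reasoning

⊕-comm : ∀ x y → x ⊕ y ≡ y ⊕ x
⊕-comm x y = toBits-injective (trans (toBits-⊕ x y)
  (trans (cong₂ _,_ (xor-comm (proj₁ (toBits x)) _) (xor-comm (proj₂ (toBits x)) _)) (sym (toBits-⊕ y x))))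

⊕-commutativeSemigroup : CommutativeSemigroup _ _
⊕-commutativeSemigroup = record
  { isCommutativeSemigroup = record
    { isSemigroup = record { isMagma = isMagma _⊕_ ; assoc = ⊕-assoc } ; comm = ⊕-comm } }

open Algebra.Properties.CommutativeSemigroup ⊕-commutativeSemigroup using (interchange)

sumF4-++ : ∀ xs ys → sumF4 (xs ++ ys) ≡ sumF4 xs ⊕ sumF4 ys
sumF4-++ []       ys = refl
sumF4-++ (x ∷ xs) ys = trans (cong (x ⊕_) (sumF4-++ xs ys)) (sym (⊕-assoc x _ _))

fromBit : Bool → F4
fromBit false = 𝟘
fromBit true  = 𝟙

fromBit-xor : ∀ a b → fromBit (a xor b) ≡ fromBit a ⊕ fromBit b
fromBit-xor false b     = refl
fromBit-xor true  false = refl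
fromBit-xor true  true  = refl

-- 1 + α^q + α^{2q} is 3 = 1 or a sum of all the cube roots of unity, which vanishes.
root-sum : ∀ q → (𝟙 ⊕ αpow (q mod 3)) ⊕ αpow ((2 * q) mod 3) ≡ fromBit (modGate 3 q)
root-sum q = trans
  (cong₂ (λ s t → (𝟙 ⊕ αpow s) ⊕ αpow t) (mod-cong q≈) (mod-cong (*-cong (≈-refl {2}) q≈)))
  (residues (q % 3) (m%n<n q 3))
  where
  q≈ : q ≈ q % 3
  q≈ = congruent (sym (m%n%n≡m%n q 3))
  residues : ∀ r → r < 3 → (𝟙 ⊕ αpow (r mod 3)) ⊕ αpow ((2 * r) mod 3) ≡ fromBit (r ≡ᵇ 0)
  residues 0 _ = refl
  residues 1 _ = refl
  residues 2 _ = refl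
  residues (suc (suc (suc r))) (s≤s (s≤s (s≤s ())))

-- The sum in F4 and the value of the circuit

module _ {n : ℕ} (suffix : List Bool) (y : Vec Bool n) (z : Vec Bool (length suffix)) where

  open Reduction n suffix

  power : Poly (n + K) → F4
  power p = αpow (evalPoly (a suffix y z) p)

  total : List (Poly (n + K)) → F4
  total ps = sumF4 (map power ps)

  total-++ : ∀ ps qs → total (ps ++ qs) ≡ total ps ⊕ total qs
  total-++ ps qs = trans (cong sumF4 (map-++ power ps qs)) (sumF4-++ (map power ps) (map power qs))

  total-c₀ : ∀ c → total (replicate c []) ≡ fromBit (parity c)
  total-c₀ zero    = refl
  total-c₀ (suc c) = trans (cong (𝟙 ⊕_) (total-c₀ c)) (sym (fromBit-xor true (parity c)))

  power-gate : ∀ φ o g → power (gatePoly φ o g) ≡ αpow ((toℕ (coef φ) * gateSum suffix y z g) mod 3)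
  power-gate φ o g = cong αpow (mod-cong (value-gate suffix y z φ o g))

  gate-value : ∀ o g → (𝟙 ⊕ power (gatePoly false o g)) ⊕ power (gatePoly true o g) ≡ fromBit (evalMod3 y g)
  gate-value o g@(mod3 c gs) = trans
    (cong₂ (λ s t → (𝟙 ⊕ s) ⊕ t)
      (trans (power-gate false o g) (cong (λ q → αpow (q mod 3)) (*-identityˡ (gateSum suffix y z g))))
      (power-gate true o g))
    (root-sum (gateSum suffix y z g))

  total-gates : ∀ o gs → total (gatePolys false o gs) ⊕ total (gatePolys true o gs) ≡
                fromBit (parity (sum (map (λ g → b2n (evalMod3 y g)) gs)))
  total-gates o []       = refl
  total-gates o (g ∷ gs) = begin
    (𝟙 ⊕ (p ⊕ rest₁)) ⊕ (q ⊕ rest₂)      ≡⟨ cong (_⊕ (q ⊕ rest₂)) (⊕-assoc 𝟙 p rest₁) ⟨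
    -- This brings together the two polynomials of one gate, written in different passes.
    ((𝟙 ⊕ p) ⊕ rest₁) ⊕ (q ⊕ rest₂)      ≡⟨ interchange (𝟙 ⊕ p) rest₁ q rest₂ ⟩
    ((𝟙 ⊕ p) ⊕ q) ⊕ (rest₁ ⊕ rest₂)      ≡⟨ cong₂ _⊕_ (gate-value o g) (total-gates _ gs) ⟩
    fromBit b ⊕ fromBit (parity s)       ≡⟨ fromBit-xor b (parity s) ⟨
    fromBit (b xor parity s)             ≡⟨ cong (λ x → fromBit (x xor parity s)) (parity-b2n b) ⟨
    fromBit (parity (b2n b) xor parity s) ≡⟨ cong fromBit (parity-+ (b2n b) s) ⟨
    fromBit (parity (b2n b + s))         ∎
    where
    open ≡-Reasoning
    p q rest₁ rest₂ : F4
    p = power (gatePoly false o g)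
    q = power (gatePoly true o g)
    rest₁ = total (gatePolys false (suc o + length (encMod3 g)) gs)
    rest₂ = total (gatePolys true (suc o + length (encMod3 g)) gs)
    b : Bool
    b = evalMod3 y g
    s : ℕ
    s = sum (map (λ g → b2n (evalMod3 y g)) gs)
    parity-b2n : ∀ b → parity (b2n b) ≡ b
    parity-b2n false = refl
    parity-b2n true  = refl

fromBit-𝟘 : ∀ b → fromBit b ≡ 𝟘 ⇔ not b ≡ true
fromBit-𝟘 false = mk⇔ (λ _ → refl) (λ _ → refl)
fromBit-𝟘 true  = mk⇔ (λ ()) (λ ())

-- The values `z` of the extra variables are arbitrary: they enter only squared, so ranging over all
-- points of the larger cube amounts to ranging over all inputs `y`.
reduction-value : ∀ C (y : Vec Bool (Circuit.n C)) z →
  sumF4 (map (λ p → αpow (evalPoly (Vec.map not y Vec.++ z) p)) (PolyInstance.polys (reduction C))) ≡ 𝟘 ⇔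
  evalCircuit C y ≡ true
reduction-value C@(circuit n c gs) y z =
  subst₂ (λ s b → s ≡ 𝟘 ⇔ b ≡ true) (sym total≡) (sym (modGate-2 (c + s))) (fromBit-𝟘 (parity (c + s)))
  where
  suffix = false ∷ body C
  open Reduction n suffix
  o = suc (length (encℕ c))
  s = sum (map (λ g → b2n (evalMod3 y g)) gs)
  tot : List (Poly (n + K)) → F4
  tot = total suffix y z
  total≡ : tot (replicate c [] ++ gatePolys false o gs ++ gatePolys true o gs) ≡ fromBit (parity (c + s))
  total≡ = begin
    tot (replicate c [] ++ gatePolys false o gs ++ gatePolys true o gs)
      ≡⟨ total-++ suffix y z (replicate c []) _ ⟩
    tot (replicate c []) ⊕ tot (gatePolys false o gs ++ gatePolys true o gs)
      ≡⟨ cong₂ _⊕_ (total-c₀ suffix y z c)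
           (trans (total-++ suffix y z (gatePolys false o gs) _) (total-gates suffix y z o gs)) ⟩
    fromBit (parity c) ⊕ fromBit (parity s)
      ≡⟨ fromBit-xor (parity c) (parity s) ⟨
    fromBit (parity c xor parity s)
      ≡⟨ cong fromBit (parity-+ c s) ⟨
    fromBit (parity (c + s)) ∎
    where open ≡-Reasoning

map-not-involutive : ∀ {n} (v : Vec Bool n) → Vec.map not (Vec.map not v) ≡ v
map-not-involutive []      = refl
map-not-involutive (b ∷ v) = cong₂ _∷_ (not-involutive b) (map-not-involutive v)

reduction-correct : ∀ C → CircuitEquivalent C ⇔ AllZero (reduction C)
reduction-correct C@(circuit n _ _) = mk⇔ forward backward
  where
  forward : CircuitEquivalent C → AllZero (reduction C)
  forward equiv a with Vec.splitAt n a
  ... | v , z , refl = subst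
    (λ w → sumF4 (map (λ p → αpow (evalPoly (w Vec.++ z) p)) (PolyInstance.polys (reduction C))) ≡ 𝟘)
    (map-not-involutive v)
    (Equivalence.from (reduction-value C (Vec.map not v) z) (equiv (Vec.map not v)))
  backward : AllZero (reduction C) → CircuitEquivalent C
  -- Any values of the extra variables would do; all of them are set to 1.
  backward zero≡ y = Equivalence.to (reduction-value C y (Vec.replicate _ true))
    (zero≡ (Vec.map not y Vec.++ Vec.replicate _ true))

theorem7p3 : CC232EquivReducesToPolyZero
theorem7p3 = transduce , transduce-polyTime , λ C → mk⇔
  (λ equiv → reduction C , reduction-valid C , sym (transduce-encCircuit C) ,
             Equivalence.to (reduction-correct C) equiv)
  (λ { (I , _ , eq , allZero) → Equivalence.from (reduction-correct C)
         (subst AllZero (encInstance-injective I (reduction C) (trans eq (transduce-encCircuit C))) allZero) })
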